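{- Let $r>s\ge 1$ be integers, and let $G$ be a $K_{r+1}$-free graph on $n$ vertices. Suppose that $m$ is an integer with \[ \alpha_s(G)\ge m\ge \left\lceil \frac{sn}{r}\right\rceil . \] Then \[ e(G)\le m(n-m)+t_{r-s}(n-m)+t_s(m). \] Moreover, equality holds if and only if $G$ is a complete $r$-partite graph whose parts can be divided into two groups: $s$ parts with total size $m$, as equal as possible, and $r-s$ parts with total size $n-m$, as equal as possible.
   Context: All graphs are finite, simple and undirected; $e(G)$ is the number of edges of $G$, and $G[M]$ is the subgraph induced by $M\subseteq V(G)$. A graph is $F$-free if it contains no (not necessarily induced) subgraph isomorphic to $F$. For $s\ge 1$, \[ \alpha_s(G)=\max\{|M|: M\subseteq V(G)\text{ and } G[M]\text{ is }K_{s+1}\text{ -free}\}. \] A graph is complete $r$-partite if its vertex set can be partitioned into $r$ independent sets (parts) such that every two vertices from distinct parts are adjacent; parts of size zero are allowed. "As equal as possible" means that the sizes of any two parts within the group differ by at most one. The Turán graph $T_r(n)$ is the complete $r$-partite graph on $n$ vertices in which any two part sizes differ by at most one, and $t_r(n)=e(T_r(n))$, with $t_r(0)=0$. -}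

module Defs where

open import Data.Fin using (Fin; toℕ; finToFun; funToFin) renaming (_<?_ to _<ᶠ?_; _≟_ to _≟ᶠ_)
open import Data.Fin.Properties using (any?; all?; finToFun-funToFin)
open import Data.Fin.Subset using (Subset; inside; outside; _∈_; ∁; ∣_∣)
open import Data.Fin.Subset.Properties using (_∈?_)
open import Data.List using (List; _++_; [_]; map; filter; length; allFin; cartesianProduct)
open import Data.List.Extrema.Nat using (max)
open import Data.Nat using (ℕ; zero; suc; _^_; _∸_; _≤_; NonZero; ∣_-_∣)
open import Data.Nat.DivMod using (_mod_)
open import Data.Nat.ListAction using (sum)
open import Data.Product using (Σ; ∃; _×_; _,_; proj₁; proj₂)
open import Data.Vec using (tabulate; here; there) renaming ([] to []ᵛ; _∷_ to _∷ᵛ_)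
open import Function using (id; _∘_)
open import Function.Definitions using (Injective)
open import Relation.Binary using (Rel; Symmetric; Irreflexive) renaming (Decidable to Decidable₂)
open import Relation.Binary.PropositionalEquality using (_≡_; _≢_; refl; sym; trans; cong; subst; subst₂; ≢-sym)
open import Relation.Nullary using (Dec; ¬_; does; ¬?; _×-dec_; _→-dec_; map′)
open import Level using (0ℓ)

-- Adjacency is decidable, as classically it always is.  A graph on n vertices
-- is a Graph (Fin n); other vertex types arise only as induced subgraphs.
record Graph (V : Set) : Set₁ where
  field
    Adj    : Rel V 0ℓ
    adj?   : Decidable₂ Adj
    symm   : Symmetric Adj
    irrefl : Irreflexive _≡_ Adj

open Graph public

e : ∀ {n} → Graph (Fin n) → ℕ
e {n} G = length (filter (λ (i , j) → i <ᶠ? j ×-dec adj? G i j)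
                         (cartesianProduct (allFin n) (allFin n)))

_[[_]] : ∀ {n} → Graph (Fin n) → (M : Subset n) → Graph (∃ λ v → v ∈ M)
G [[ M ]] = record
  { Adj    = λ u v → Adj G (proj₁ u) (proj₁ v)
  ; adj?   = λ u v → adj? G (proj₁ u) (proj₁ v)
  ; symm   = symm G
  ; irrefl = λ u≡v → irrefl G (cong proj₁ u≡v)
  }

-- G has a (not necessarily induced) subgraph isomorphic to F.
_Contains_ : ∀ {V W : Set} → Graph V → Graph W → Set
_Contains_ {V} {W} G F =
  Σ (W → V) λ f → Injective _≡_ _≡_ f × (∀ u v → Adj F u v → Adj G (f u) (f v))

_IsFreeOf_ : ∀ {V W : Set} → Graph V → Graph W → Set
G IsFreeOf F = ¬ (G Contains F)

multipartite : ∀ {n r} → (Fin n → Fin r) → Graph (Fin n)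
multipartite P = record
  { Adj    = λ u v → P u ≢ P v
  ; adj?   = λ u v → ¬? (P u ≟ᶠ P v)
  ; symm   = ≢-sym
  ; irrefl = λ u≡v Pu≢Pv → Pu≢Pv (cong P u≡v)
  }

K : ∀ k → Graph (Fin k)
K k = multipartite id

-- The parts are the residue classes modulo r among 0, …, n - 1, whose sizes
-- are ⌊n/r⌋ or ⌈n/r⌉.
turán : ∀ r .{{_ : NonZero r}} n → Graph (Fin n)
turán r n = multipartite (λ v → toℕ v mod r)

t : ∀ r .{{_ : NonZero r}} → ℕ → ℕ
t r n = e (turán r n)

∈-irrelevant : ∀ {n} {v : Fin n} {M : Subset n} (p q : v ∈ M) → p ≡ q
∈-irrelevant here      here      = refl
∈-irrelevant (there p) (there q) = cong there (∈-irrelevant p q)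

contains? : ∀ {n k} (G : Graph (Fin n)) (M : Subset n) (F : Graph (Fin k)) →
            Dec ((G [[ M ]]) Contains F)
contains? {n} {k} G M F = map′ decode encode (any? good?)
  where
  Good : Fin (n ^ k) → Set
  Good c = (∀ u → g u ∈ M)
         × (∀ u v → g u ≡ g v → u ≡ v)
         × (∀ u v → Adj F u v → Adj G (g u) (g v))
    where
    g : Fin k → Fin n
    g = finToFun c

  good? : ∀ c → Dec (Good c)
  good? c = all? (λ u → g u ∈? M)
      ×-dec all? (λ u → all? λ v → (g u ≟ᶠ g v) →-dec (u ≟ᶠ v))
      ×-dec all? (λ u → all? λ v → adj? F u v →-dec adj? G (g u) (g v))
    where
    g : Fin k → Fin n
    g = finToFun c

  decode : ∃ Good → (G [[ M ]]) Contains F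
  decode (c , mem , inj , hom) =
    (λ u → finToFun c u , mem u) , (λ eq → inj _ _ (cong proj₁ eq)) , hom

  ∈-ext : {x y : ∃ λ v → v ∈ M} → proj₁ x ≡ proj₁ y → x ≡ y
  ∈-ext {x , p} {_ , q} refl = cong (x ,_) (∈-irrelevant p q)

  encode : (G [[ M ]]) Contains F → ∃ Good
  encode (f , inj , hom) = funToFin h
    , (λ u → subst (_∈ M) (sym (β u)) (proj₂ (f u)))
    , (λ u v eq → inj (∈-ext (trans (sym (β u)) (trans eq (β v)))))
    , (λ u v uv → subst₂ (Adj G) (sym (β u)) (sym (β v)) (hom u v uv))
    where
    h : Fin k → Fin n
    h = proj₁ ∘ f

    β : ∀ u → finToFun (funToFin h) u ≡ h u
    β = finToFun-funToFin h

subsets : ∀ n → List (Subset n)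
subsets zero    = [ []ᵛ ]
subsets (suc n) = map (outside ∷ᵛ_) (subsets n) ++ map (inside ∷ᵛ_) (subsets n)

-- The default value 0 of max is harmless: the empty set always qualifies.
α : ∀ {n} → ℕ → Graph (Fin n) → ℕ
α {n} s G = max 0 (map ∣_∣ (filter (λ M → ¬? (contains? G M (K (suc s)))) (subsets n)))

-- P assigns to each vertex its part; parts may be empty.
IsCompleteMultipartite : ∀ {n r} → Graph (Fin n) → (Fin n → Fin r) → Set
IsCompleteMultipartite G P =
    (∀ u v → P u ≡ P v → ¬ Adj G u v)
  × (∀ u v → P u ≢ P v → Adj G u v)

partSize : ∀ {n r} → (Fin n → Fin r) → Fin r → ℕ
partSize P i = ∣ tabulate (λ v → does (P v ≟ᶠ i)) ∣

-- The parts with indices in S are k in number, have total size N, and are as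
-- equal as possible.
record IsBalancedGroup {n r} (P : Fin n → Fin r) (S : Subset r) (k N : ℕ) : Set where
  field
    count     : ∣ S ∣ ≡ k
    totalSize : sum (map (partSize P) (filter (_∈? S) (allFin r))) ≡ N
    balanced  : ∀ i j → i ∈ S → j ∈ S → ∣ partSize P i - partSize P j ∣ ≤ 1

IsExtremal : ∀ {n} (r s m : ℕ) → Graph (Fin n) → Set
IsExtremal {n} r s m G =
  Σ (Fin n → Fin r) λ P → IsCompleteMultipartite G P ×
    ∃ λ S → IsBalancedGroup P S s m × IsBalancedGroup P (∁ S) (r ∸ s) (n ∸ m)

-- Let W count the ordered nonadjacent pairs of G, loops included, so that 2 e(G) + W = n², and W = Σ aᵢ²
-- for a complete multipartite graph with part sizes aᵢ.  Since a² ≥ (2k+1) a − k(k+1), with equality iff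
-- a ∈ {k, k+1}, the bound amounts to
--   (2k+1) |M| + (2l+1) |V ∖ M| ≤ W + s k(k+1) + (r−s) l(l+1)
-- for every K_{s+1}-free M, where k = ⌊m/s⌋ ≥ l = ⌊(n−m)/(r−s)⌋.  It holds for all integers k ≥ l by
-- induction: deleting an r-clique Q, which has at most s vertices in M, turns k, l into k−1, l−1 because
-- every vertex has a nonneighbour in Q; without r-cliques, r can be lowered.  In the case of equality
-- every vertex has exactly one nonneighbour in every r-clique, which makes nonadjacency an equivalence
-- relation; the part sizes are then read off from the equality case of the inequality for a².
module Submission where

open import Defs
open import Data.Bool using (Bool; true; false; if_then_else_)
open import Data.Fin using (Fin; zero; suc; toℕ; inject≤; _≟_) renaming (_<?_ to _<ᶠ?_)
open import Data.Fin.Properties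
  using (any?; suc-injective; <-cmp; inject≤-injective; toℕ-inject₁; toℕ-fromℕ; toℕ-injective; toℕ-fromℕ<; toℕ<n)
open import Data.Fin.Subset using (Subset; inside; outside; _∈_; _⊆_; ∁; ∣_∣; ⊤; ⊥)
open import Data.Fin.Subset.Properties
  using (_∈?_; x∈∁p⇒x∉p; x∉p⇒x∈∁p; ∈⊤; ∣⊤∣≡n; ∣p∣≤n; ∣∁p∣≡n∸∣p∣; out⊆; in⊆in; ∉⊥)
import Data.Integer as ℤ
import Data.Integer.DivMod as ℤ
import Data.Integer.Properties as ℤ
import Data.Integer.Tactic.RingSolver as ℤ-solver
open import Data.List as List using (List; []; _∷_; _++_; map; filter; length; allFin; cartesianProduct)
import Data.List.Extrema.Nat as Extrema
open import Data.List.Membership.Propositional using () renaming (_∈_ to _∈ˡ_)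
open import Data.List.Membership.Propositional.Properties using (∈-map⁻; ∈-filter⁻)
open import Data.List.Properties using (map-tabulate; map-cong; filter-++; length-++)
open import Data.Nat as ℕ hiding (_≟_; _/_; <-cmp)
open import Data.Nat.DivMod
  using (_mod_; [m+kn]%n≡m%n; m<n⇒m%n≡m; m≡m%n+[m/n]*n; m%n<n; m<n*o⇒m/o<n; m*n/n≡m; m/n*n≤m; /-monoˡ-≤)
open import Data.Nat.ListAction using () renaming (sum to sumˡ)
open import Data.Nat.Properties hiding (_≟_; suc-injective; <-cmp)
open import Data.Nat.Tactic.RingSolver using (solve-∀)
open import Data.Product using (Σ; ∃; _×_; _,_; proj₁; proj₂)
open import Data.Rational.Unnormalised using (ceiling; _/_)
open import Data.Sum using (_⊎_; inj₁; inj₂)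
open import Data.Vec using ([]; _∷_; tabulate)
open import Data.Vec.Properties using ([]=⇒lookup; lookup⇒[]=; lookup∘tabulate)
open import Function using (_∘_; id)
open import Function.Bundles using (_⇔_; mk⇔)
open import Relation.Binary.Definitions using (tri<; tri≈; tri>)
open import Relation.Binary.PropositionalEquality
open import Relation.Nullary using (Dec; yes; no; does; ¬_; ¬?; _×-dec_; contradiction)
open import Relation.Nullary.Decidable using (dec-true; dec-false)
open import Algebra.Properties.Semiring.Sum +-*-semiring

-- Chords of fixed slope make the target linear in |M|, so the induction may remove any number of
-- vertices from M and never has to follow the rounding in Turán numbers. Each deletion of Q lowers
-- both slopes by 2; every surviving vertex pays for this with at least two ordered nonadjacent
-- pairs to Q, and the remainder is 2(k-l)(s-p), where p ≤ s vertices of Q lie in M. The condition m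
-- ≥ sn/r enters only as k ≥ l. This makes the remainder nonnegative, and it makes the weight grow
-- with |M|, so that a set M larger than m is as good as one of size m. The obstacle in the case of
-- equality is k = l. Then M may be strictly larger than m, and the s parts that cover M need not
-- have total size m. But now all parts have size k or k+1, and s of them with total m can be
-- selected afresh.

⟦_⟧ : ∀ {P : Set} → Dec P → ℕ
⟦ P? ⟧ = if does P? then 1 else 0

⟦⟧-true : ∀ {P : Set} (P? : Dec P) → P → ⟦ P? ⟧ ≡ 1
⟦⟧-true P? p rewrite dec-true P? p = refl

⟦⟧-false : ∀ {P : Set} (P? : Dec P) → ¬ P → ⟦ P? ⟧ ≡ 0
⟦⟧-false P? ¬p rewrite dec-false P? ¬p = refl

⟦⟧-cong : ∀ {P Q : Set} (P? : Dec P) (Q? : Dec Q) → (P → Q) → (Q → P) → ⟦ P? ⟧ ≡ ⟦ Q? ⟧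
⟦⟧-cong (yes p) Q? f g = sym (⟦⟧-true Q? (f p))
⟦⟧-cong (no ¬p) Q? f g = sym (⟦⟧-false Q? (¬p ∘ g))

χ : ∀ {n} → Subset n → Fin n → ℕ
χ U v = ⟦ v ∈? U ⟧

-- Finite sums and their equality cases

sum-mono-≤ : ∀ {n} {f g : Fin n → ℕ} → (∀ i → f i ≤ g i) → sum f ≤ sum g
sum-mono-≤ {zero}  f≤g = z≤n
sum-mono-≤ {suc n} f≤g = +-mono-≤ (f≤g zero) (sum-mono-≤ (f≤g ∘ suc))

+-tightˡ : ∀ {a b c d} → a ≤ b → c ≤ d → b + d ≤ a + c → b ≤ a
+-tightˡ {a} {b} {c} {d} a≤b c≤d bd≤ac =
  +-cancelʳ-≤ d b a (≤-trans bd≤ac (+-monoʳ-≤ a c≤d))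

+-tightʳ : ∀ {a b c d} → a ≤ b → c ≤ d → b + d ≤ a + c → d ≤ c
+-tightʳ {a} {b} {c} {d} a≤b c≤d bd≤ac =
  +-cancelˡ-≤ b d c (≤-trans bd≤ac (+-monoˡ-≤ c a≤b))

-- A tight total leaves no slack in any term. All local information in the case of equality is
-- extracted this way.
sum-tight : ∀ {n} {f g : Fin n → ℕ} → (∀ i → f i ≤ g i) → sum g ≤ sum f → ∀ i → g i ≤ f i
sum-tight f≤g g≤f zero    = +-tightˡ (f≤g zero) (sum-mono-≤ (f≤g ∘ suc)) g≤f
sum-tight f≤g g≤f (suc i) =
  sum-tight (f≤g ∘ suc) (+-tightʳ (f≤g zero) (sum-mono-≤ (f≤g ∘ suc)) g≤f) i

sum-const : ∀ n c → sum {n} (λ _ → c) ≡ n * c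
sum-const zero    c = refl
sum-const (suc n) c = cong (c +_) (sum-const n c)

sum-zero : ∀ {n} (f : Fin n → ℕ) → (∀ i → f i ≡ 0) → sum f ≡ 0
sum-zero {n} f f≡0 = trans (sum-cong-≗ f≡0) (trans (sum-const n 0) (*-zeroʳ n))

term≤sum : ∀ {n} (f : Fin n → ℕ) i → f i ≤ sum f
term≤sum f zero    = m≤m+n _ _
term≤sum f (suc i) = ≤-trans (term≤sum (f ∘ suc) i) (m≤n+m _ _)

sum-δ : ∀ {n} (i : Fin n) (f : Fin n → ℕ) → sum (λ j → ⟦ i ≟ j ⟧ * f j) ≡ f i
sum-δ {suc n} zero f =
  trans (cong (1 * f zero +_) (sum-zero {n} _ (λ _ → refl))) (trans (+-identityʳ _) (*-identityˡ _))
sum-δ {suc n} (suc i) f = trans (sum-cong-≗ (λ j → cong (_* f (suc j)) (lemma j))) (sum-δ i (f ∘ suc))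
  where
  lemma : ∀ j → ⟦ suc i ≟ suc j ⟧ ≡ ⟦ i ≟ j ⟧
  lemma j = ⟦⟧-cong (suc i ≟ suc j) (i ≟ j) suc-injective (cong suc)

sum-δ₁ : ∀ {n} (i : Fin n) → sum (λ j → ⟦ i ≟ j ⟧) ≡ 1
sum-δ₁ i = trans (sum-cong-≗ (λ j → sym (*-identityʳ ⟦ i ≟ j ⟧))) (sum-δ i (λ _ → 1))

sum≤1⇒unique : ∀ {n} (f : Fin n → ℕ) → sum f ≤ 1 → ∀ i j → f i ≡ 1 → f j ≡ 1 → i ≡ j
sum≤1⇒unique f Σ≤1 i j fi fj with i ≟ j
... | yes i≡j = i≡j
... | no  i≢j = contradiction (≤-trans (≤-reflexive (sym Σδ)) (≤-trans (sum-mono-≤ below) Σ≤1)) λ { (s≤s ()) }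
  where
  -- Two distinct indices would put the sum of their indicators, which is 2, below `f`.
  Σδ : sum (λ l → ⟦ i ≟ l ⟧ + ⟦ j ≟ l ⟧) ≡ 2
  Σδ = trans (∑-distrib-+ (λ l → ⟦ i ≟ l ⟧) (λ l → ⟦ j ≟ l ⟧)) (cong₂ _+_ (sum-δ₁ i) (sum-δ₁ j))
  below : ∀ l → ⟦ i ≟ l ⟧ + ⟦ j ≟ l ⟧ ≤ f l
  below l with i ≟ l | j ≟ l
  ... | yes refl | yes refl = contradiction refl i≢j
  ... | yes refl | no _     = ≤-reflexive (sym fi)
  ... | no _     | yes refl = ≤-reflexive (sym fj)
  ... | no _     | no _     = z≤n

-- Cardinalities, filters and products as sums

∣tabulate∣ : ∀ {n} (b : Fin n → Bool) → ∣ tabulate b ∣ ≡ sum (λ v → if b v then 1 else 0)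
∣tabulate∣ {zero}  b = refl
∣tabulate∣ {suc n} b with b zero
... | true  = cong suc (∣tabulate∣ (b ∘ suc))
... | false = ∣tabulate∣ (b ∘ suc)

∣p∣≡sum-χ : ∀ {n} (p : Subset n) → ∣ p ∣ ≡ sum (χ p)
∣p∣≡sum-χ []            = refl
∣p∣≡sum-χ (inside  ∷ p) = cong suc (∣p∣≡sum-χ p)
∣p∣≡sum-χ (outside ∷ p) = ∣p∣≡sum-χ p

χ-∁ : ∀ {n} (p : Subset n) v → χ p v + χ (∁ p) v ≡ 1
χ-∁ p v with v ∈? p
... | yes v∈p = cong (1 +_) (⟦⟧-false (v ∈? ∁ p) (λ v∈∁p → x∈∁p⇒x∉p v∈∁p v∈p))
... | no  v∉p = ⟦⟧-true (v ∈? ∁ p) (x∉p⇒x∈∁p v∉p)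

sum-χ-∁ : ∀ {n} (p : Subset n) (f : Fin n → ℕ) →
          sum (λ i → χ p i * f i) + sum (λ i → χ (∁ p) i * f i) ≡ sum f
sum-χ-∁ p f = begin
  sum (λ i → χ p i * f i) + sum (λ i → χ (∁ p) i * f i)
    ≡⟨ ∑-distrib-+ (λ i → χ p i * f i) (λ i → χ (∁ p) i * f i) ⟨
  sum (λ i → χ p i * f i + χ (∁ p) i * f i)
    ≡⟨ sum-cong-≗ (λ i → trans (sym (*-distribʳ-+ (f i) (χ p i) (χ (∁ p) i)))
                               (trans (cong (_* f i) (χ-∁ p i)) (*-identityˡ (f i)))) ⟩
  sum f ∎
  where open ≡-Reasoning

∈-tabulate⁺ : ∀ {n} {P : Fin n → Set} (P? : ∀ v → Dec (P v)) {v} → P v → v ∈ tabulate (λ v → does (P? v))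
∈-tabulate⁺ P? {v} p = lookup⇒[]= v _ (trans (lookup∘tabulate (λ v → does (P? v)) v) (dec-true (P? v) p))

∈-tabulate⁻ : ∀ {n} {P : Fin n → Set} (P? : ∀ v → Dec (P v)) {v} → v ∈ tabulate (λ v → does (P? v)) → P v
∈-tabulate⁻ P? {v} v∈ with P? v | trans (sym (lookup∘tabulate (λ v → does (P? v)) v)) ([]=⇒lookup v∈)
... | yes p | _  = p
... | no  _ | ()

sumˡ-filter : ∀ {A : Set} {Q : A → Set} (Q? : ∀ x → Dec (Q x)) (f : A → ℕ) xs →
              sumˡ (map f (filter Q? xs)) ≡ sumˡ (map (λ x → ⟦ Q? x ⟧ * f x) xs)
sumˡ-filter Q? f []       = refl
sumˡ-filter Q? f (x ∷ xs) with does (Q? x)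
... | true  = cong₂ _+_ (sym (*-identityˡ (f x))) (sumˡ-filter Q? f xs)
... | false = sumˡ-filter Q? f xs

sumˡ-tabulate : ∀ {n} (f : Fin n → ℕ) → sumˡ (List.tabulate f) ≡ sum f
sumˡ-tabulate {zero}  f = refl
sumˡ-tabulate {suc n} f = cong (f zero +_) (sumˡ-tabulate (f ∘ suc))

sumˡ-allFin : ∀ {n} (f : Fin n → ℕ) → sumˡ (map f (allFin n)) ≡ sum f
sumˡ-allFin f = trans (cong sumˡ (map-tabulate id f)) (sumˡ-tabulate f)

length-filter : ∀ {A : Set} {Q : A → Set} (Q? : ∀ x → Dec (Q x)) xs →
                length (filter Q? xs) ≡ sumˡ (map (λ x → ⟦ Q? x ⟧) xs)
length-filter Q? []       = refl
length-filter Q? (x ∷ xs) with does (Q? x)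
... | true  = cong suc (length-filter Q? xs)
... | false = length-filter Q? xs

length-filter-× : ∀ {A B : Set} {Q : A × B → Set} (Q? : ∀ x → Dec (Q x)) xs ys →
  length (filter Q? (cartesianProduct xs ys)) ≡ sumˡ (map (λ x → sumˡ (map (λ y → ⟦ Q? (x , y) ⟧) ys)) xs)
length-filter-× Q? []       ys = refl
length-filter-× Q? (x ∷ xs) ys = begin
  length (filter Q? (map (x ,_) ys ++ cartesianProduct xs ys))
    ≡⟨ cong length (filter-++ Q? (map (x ,_) ys) _) ⟩
  length (filter Q? (map (x ,_) ys) ++ filter Q? (cartesianProduct xs ys))
    ≡⟨ length-++ (filter Q? (map (x ,_) ys)) ⟩
  length (filter Q? (map (x ,_) ys)) + length (filter Q? (cartesianProduct xs ys))
    ≡⟨ cong₂ _+_ (row ys) (length-filter-× Q? xs ys) ⟩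
  sumˡ (map (λ y → ⟦ Q? (x , y) ⟧) ys) + sumˡ (map (λ x → sumˡ (map (λ y → ⟦ Q? (x , y) ⟧) ys)) xs) ∎
  where
  open ≡-Reasoning
  row : ∀ zs → length (filter Q? (map (x ,_) zs)) ≡ sumˡ (map (λ y → ⟦ Q? (x , y) ⟧) zs)
  row []       = refl
  row (z ∷ zs) with does (Q? (x , z))
  ... | true  = cong suc (row zs)
  ... | false = row zs

-- Turns a count into actual witnesses: too many clique vertices inside M, or too many parts met by
-- M, become a forbidden clique.
pick-distinct : ∀ {k} {Q : Fin k → Set} (Q? : ∀ i → Dec (Q i)) m → m ≤ sum (λ i → ⟦ Q? i ⟧) →
  Σ (Fin m → Fin k) λ h → (∀ i → Q (h i)) × (∀ i j → i ≢ j → h i ≢ h j)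
pick-distinct Q? zero m≤ = (λ ()) , (λ ()) , λ ()
pick-distinct {suc k} Q? (suc m) m≤ with Q? zero
... | no _ with pick-distinct (Q? ∘ suc) (suc m) m≤
...   | h , Qh , h≢ = suc ∘ h , Qh , λ i j i≢j eq → h≢ i j i≢j (suc-injective eq)
pick-distinct {suc k} {Q} Q? (suc m) (s≤s m≤) | yes q with pick-distinct (Q? ∘ suc) m m≤
...   | h , Qh , h≢ = h′ , Qh′ , h′≢
  where
  h′ : Fin (suc m) → Fin (suc k)
  h′ zero    = zero
  h′ (suc i) = suc (h i)
  Qh′ : ∀ i → Q (h′ i)
  Qh′ zero    = q
  Qh′ (suc i) = Qh i
  h′≢ : ∀ i j → i ≢ j → h′ i ≢ h′ j
  h′≢ zero    zero    i≢j _  = i≢j refl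
  h′≢ (suc i) (suc j) i≢j eq = h≢ i j (i≢j ∘ cong suc) (suc-injective eq)

-- Counting nonadjacent pairs

-- Loops count as nonadjacencies, so that an independent set of size a contributes a * a.
A̅ : ∀ {n} → Graph (Fin n) → Fin n → Fin n → ℕ
A̅ G u v = ⟦ ¬? (adj? G u v) ⟧

A̅-sym : ∀ {n} (G : Graph (Fin n)) u v → A̅ G u v ≡ A̅ G v u
A̅-sym G u v = ⟦⟧-cong (¬? (adj? G u v)) (¬? (adj? G v u)) (_∘ symm G) (_∘ symm G)

A̅-¬Adj : ∀ {n} (G : Graph (Fin n)) {u v} → ¬ Adj G u v → A̅ G u v ≡ 1
A̅-¬Adj G {u} {v} = ⟦⟧-true (¬? (adj? G u v))

A̅-loop : ∀ {n} (G : Graph (Fin n)) u → A̅ G u u ≡ 1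
A̅-loop G u = A̅-¬Adj G (irrefl G refl)

nonadjacencies : ∀ {n} → Graph (Fin n) → Subset n → ℕ
nonadjacencies G U = sum (λ u → χ U u * sum (λ v → χ U v * A̅ G u v))

χ-⊤ : ∀ {n} (v : Fin n) → χ ⊤ v ≡ 1
χ-⊤ v = ⟦⟧-true (v ∈? ⊤) ∈⊤

sum-χ-⊤ : ∀ {n} (f : Fin n → ℕ) → sum (λ v → χ ⊤ v * f v) ≡ sum f
sum-χ-⊤ f = sum-cong-≗ (λ v → trans (cong (_* f v) (χ-⊤ v)) (*-identityˡ (f v)))

nonadjacencies-⊤ : ∀ {n} (G : Graph (Fin n)) →
                   nonadjacencies G ⊤ ≡ sum (λ u → sum (λ v → A̅ G u v))
nonadjacencies-⊤ G = trans (sum-χ-⊤ (λ u → sum (λ v → χ ⊤ v * A̅ G u v)))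
                           (sum-cong-≗ (λ u → sum-χ-⊤ (A̅ G u)))

e+e+nonadjacencies : ∀ {n} (G : Graph (Fin n)) → e G + e G + nonadjacencies G ⊤ ≡ n * n
e+e+nonadjacencies {n} G = begin
  e G + e G + nonadjacencies G ⊤
    ≡⟨ cong₂ _+_ (cong₂ _+_ e≡ (trans e≡ (∑-comm up))) (nonadjacencies-⊤ G) ⟩
  sum (λ u → sum (up u)) + sum (λ u → sum (λ v → up v u)) + sum (λ u → sum (A̅ G u))
    ≡⟨ cong (_+ sum (λ u → sum (A̅ G u))) (∑-distrib-+ (λ u → sum (up u)) (λ u → sum (λ v → up v u))) ⟨
  sum (λ u → sum (up u) + sum (λ v → up v u)) + sum (λ u → sum (A̅ G u))
    ≡⟨ ∑-distrib-+ (λ u → sum (up u) + sum (λ v → up v u)) (λ u → sum (A̅ G u)) ⟨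
  sum (λ u → sum (up u) + sum (λ v → up v u) + sum (A̅ G u))
    ≡⟨ sum-cong-≗ row ⟩
  sum {n} (λ _ → n)
    ≡⟨ sum-const n n ⟩
  n * n ∎
  where
  open ≡-Reasoning
  up : Fin n → Fin n → ℕ
  up u v = ⟦ u <ᶠ? v ×-dec adj? G u v ⟧

  e≡ : e G ≡ sum (λ u → sum (up u))
  e≡ = trans (length-filter-× (λ (i , j) → i <ᶠ? j ×-dec adj? G i j) (allFin n) (allFin n))
      (trans (cong sumˡ (map-cong (λ u → sumˡ-allFin (up u)) (allFin n)))
             (sumˡ-allFin (λ u → sum (up u))))

  trichotomy : ∀ u v → up u v + up v u + A̅ G u v ≡ 1
  trichotomy u v with <-cmp u v
  ... | tri≈ u≮v refl _ rewrite ⟦⟧-false (u <ᶠ? u ×-dec adj? G u u) (u≮v ∘ proj₁) = A̅-loop G u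
  ... | tri< u<v _ v≮u
    rewrite ⟦⟧-false (v <ᶠ? u ×-dec adj? G v u) (v≮u ∘ proj₁)
          | ⟦⟧-cong (u <ᶠ? v ×-dec adj? G u v) (adj? G u v) proj₂ (u<v ,_) with adj? G u v
  ...   | yes _ = refl
  ...   | no  _ = refl
  trichotomy u v | tri> u≮v _ v<u
    rewrite ⟦⟧-false (u <ᶠ? v ×-dec adj? G u v) (u≮v ∘ proj₁)
          | ⟦⟧-cong (v <ᶠ? u ×-dec adj? G v u) (adj? G u v) (symm G ∘ proj₂) (λ uv → v<u , symm G uv)
    with adj? G u v
  ...   | yes _ = refl
  ...   | no  _ = refl

  row : ∀ u → sum (up u) + sum (λ v → up v u) + sum (A̅ G u) ≡ n
  row u = begin
    sum (up u) + sum (λ v → up v u) + sum (A̅ G u)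
      ≡⟨ cong (_+ sum (A̅ G u)) (∑-distrib-+ (up u) (λ v → up v u)) ⟨
    sum (λ v → up u v + up v u) + sum (A̅ G u)
      ≡⟨ ∑-distrib-+ (λ v → up u v + up v u) (A̅ G u) ⟨
    sum (λ v → up u v + up v u + A̅ G u v)
      ≡⟨ sum-cong-≗ (trichotomy u) ⟩
    sum {n} (λ _ → 1)
      ≡⟨ trans (sum-const n 1) (*-identityʳ n) ⟩
    n ∎

-- Cliques

-- Membership is a predicate, so that cliques in U ∩ M need no intersection of subsets. Injectivity
-- is not a field because irreflexivity already yields `distinct`.
record Clique {n} (G : Graph (Fin n)) (P : Fin n → Set) (k : ℕ) : Set where
  constructor clique
  field
    vertex   : Fin k → Fin n
    member   : ∀ i → P (vertex i)
    adjacent : ∀ i j → i ≢ j → Adj G (vertex i) (vertex j)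

  distinct : ∀ i j → vertex i ≡ vertex j → i ≡ j
  distinct i j eq with i ≟ j
  ... | yes i≡j = i≡j
  ... | no  i≢j = contradiction (adjacent i j i≢j) (irrefl G eq)

open Clique

contains⇒clique : ∀ {n} {G : Graph (Fin n)} {U k} → (G [[ U ]]) Contains (K k) → Clique G (_∈ U) k
contains⇒clique (f , _ , hom) = clique (proj₁ ∘ f) (proj₂ ∘ f) hom

clique⇒contains : ∀ {n} {G : Graph (Fin n)} {U k} → Clique G (_∈ U) k → (G [[ U ]]) Contains (K k)
clique⇒contains Q = (λ i → vertex Q i , member Q i) , (λ eq → distinct Q _ _ (cong proj₁ eq)) , adjacent Q

clique? : ∀ {n} (G : Graph (Fin n)) U k → Dec (Clique G (_∈ U) k)
clique? G U k with contains? G U (K k)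
... | yes c = yes (contains⇒clique c)
... | no ¬c = no (¬c ∘ clique⇒contains)

weaken : ∀ {n} {G : Graph (Fin n)} {P Q k} → (∀ {v} → P v → Q v) → Clique G P k → Clique G Q k
weaken P⇒Q (clique f m a) = clique f (λ i → P⇒Q (m i)) a

subclique : ∀ {n} {G : Graph (Fin n)} {P R k l} (Q : Clique G P k) (h : Fin l → Fin k) →
            (∀ i → R (vertex Q (h i))) → (∀ i j → i ≢ j → h i ≢ h j) → Clique G R l
subclique Q h Rh h≢ = clique (vertex Q ∘ h) Rh (λ i j i≢j → adjacent Q _ _ (h≢ i j i≢j))

extend : ∀ {n} {G : Graph (Fin n)} {P k} (Q : Clique G P k) {u} → P u →
         (∀ i → Adj G u (vertex Q i)) → Clique G P (suc k)
extend {n} {G} {P} {k} Q {u} Pu u~Q = clique f m a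
  where
  f : Fin (suc k) → Fin n
  f zero    = u
  f (suc i) = vertex Q i
  m : ∀ i → P (f i)
  m zero    = Pu
  m (suc i) = member Q i
  a : ∀ i j → i ≢ j → Adj G (f i) (f j)
  a zero    zero    i≢j = contradiction refl i≢j
  a zero    (suc j) i≢j = u~Q j
  a (suc i) zero    i≢j = symm G (u~Q i)
  a (suc i) (suc j) i≢j = adjacent Q i j (i≢j ∘ cong suc)

replace : ∀ {n} {G : Graph (Fin n)} {P k} (Q : Clique G P k) i {u} → P u →
          (∀ j → j ≢ i → Adj G u (vertex Q j)) →
          Σ (Clique G P k) λ Q′ → vertex Q′ i ≡ u × (∀ j → j ≢ i → vertex Q′ j ≡ vertex Q j)
replace {n} {G} {P} {k} Q i {u} Pu u~Q = clique f m a , f-i , f-j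
  where
  f : Fin k → Fin n
  f j with j ≟ i
  ... | yes _ = u
  ... | no  _ = vertex Q j
  f-i : f i ≡ u
  f-i with i ≟ i
  ... | yes _  = refl
  ... | no i≢i = contradiction refl i≢i
  f-j : ∀ j → j ≢ i → f j ≡ vertex Q j
  f-j j j≢i with j ≟ i
  ... | yes j≡i = contradiction j≡i j≢i
  ... | no _    = refl
  m : ∀ j → P (f j)
  m j with j ≟ i
  ... | yes _ = Pu
  ... | no _  = member Q j
  a : ∀ j l → j ≢ l → Adj G (f j) (f l)
  a j l j≢l with j ≟ i | l ≟ i
  ... | yes j≡i | yes l≡i = contradiction (trans j≡i (sym l≡i)) j≢l
  ... | yes _   | no l≢i  = u~Q l l≢i
  ... | no j≢i  | yes _   = symm G (u~Q j j≢i)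
  ... | no _    | no _    = adjacent Q j l j≢l

-- The degree of u into Q in the complement with loops: a vertex of Q is counted as its own
-- nonneighbour.
codegree : ∀ {n k} {G : Graph (Fin n)} {P} → Clique G P k → Fin n → ℕ
codegree {G = G} Q u = sum (λ i → A̅ G u (vertex Q i))

codegree-vertex : ∀ {n k} {G : Graph (Fin n)} {P} (Q : Clique G P k) i → codegree Q (vertex Q i) ≡ 1
codegree-vertex {G = G} Q i = trans (sum-cong-≗ lemma) (sum-δ₁ i)
  where
  lemma : ∀ j → A̅ G (vertex Q i) (vertex Q j) ≡ ⟦ i ≟ j ⟧
  lemma j = ⟦⟧-cong (¬? (adj? G _ _)) (i ≟ j) f λ { refl → irrefl G refl }
    where
    f : ¬ Adj G (vertex Q i) (vertex Q j) → i ≡ j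
    f ¬ij with i ≟ j
    ... | yes i≡j = i≡j
    ... | no  i≢j = contradiction (adjacent Q i j i≢j) ¬ij

-- A vertex adjacent to all of Q would extend it to a larger clique.
nonneighbour : ∀ {n k} {G : Graph (Fin n)} {P} (Q : Clique G P k) → ¬ Clique G P (suc k) →
               ∀ {u} → P u → ∃ λ i → ¬ Adj G u (vertex Q i)
nonneighbour {G = G} Q free {u} Pu with any? (λ i → ¬? (adj? G u (vertex Q i)))
... | yes found = found
... | no  none  = contradiction (extend Q Pu u~Q) free
  where
  u~Q : ∀ i → Adj G u (vertex Q i)
  u~Q i with adj? G u (vertex Q i)
  ... | yes ui = ui
  ... | no ¬ui = contradiction (i , ¬ui) none

codegree≥1 : ∀ {n k} {G : Graph (Fin n)} {P} (Q : Clique G P k) → ¬ Clique G P (suc k) →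
             ∀ {u} → P u → 1 ≤ codegree Q u
codegree≥1 {G = G} Q free {u} Pu with nonneighbour Q free Pu
... | i , ¬ui = ≤-trans (≤-reflexive (sym (A̅-¬Adj G ¬ui))) (term≤sum (λ i → A̅ G u (vertex Q i)) i)

-- Deleting a clique

module Removal {n k} {G : Graph (Fin n)} {U : Subset n} (Q : Clique G (_∈ U) k) where

  remains? : ∀ v → Dec (v ∈ U × ¬ ∃ λ i → vertex Q i ≡ v)
  remains? v = v ∈? U ×-dec ¬? (any? λ i → vertex Q i ≟ v)

  rest : Subset n
  rest = tabulate (λ v → does (remains? v))

  rest⊆U : ∀ {v} → v ∈ rest → v ∈ U
  rest⊆U v∈ = proj₁ (∈-tabulate⁻ remains? v∈)

  χ-split : ∀ v → χ U v ≡ χ rest v + sum (λ i → ⟦ vertex Q i ≟ v ⟧)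
  χ-split v with any? (λ i → vertex Q i ≟ v)
  ... | yes (i , refl) = trans (⟦⟧-true (v ∈? U) (member Q i)) (sym (cong₂ _+_ out once))
    where
    out : χ rest v ≡ 0
    out = ⟦⟧-false (v ∈? rest) (λ v∈ → proj₂ (∈-tabulate⁻ remains? v∈) (i , refl))
    once : sum (λ j → ⟦ vertex Q j ≟ v ⟧) ≡ 1
    once = trans (sum-cong-≗ λ j → ⟦⟧-cong (vertex Q j ≟ v) (i ≟ j)
                                     (λ eq → distinct Q i j (sym eq)) (λ { refl → refl }))
                 (sum-δ₁ i)
  ... | no ∄i = trans (⟦⟧-cong (v ∈? U) (v ∈? rest) (λ v∈ → ∈-tabulate⁺ remains? (v∈ , ∄i)) rest⊆U)
                (trans (sym (+-identityʳ _))
                       (cong (χ rest v +_) (sym (sum-zero {k} _ λ i → ⟦⟧-false (vertex Q i ≟ v) (λ eq → ∄i (i , eq))))))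

  sum-split : ∀ (g : Fin n → ℕ) →
              sum (λ v → χ U v * g v) ≡ sum (λ v → χ rest v * g v) + sum (λ i → g (vertex Q i))
  sum-split g = begin
    sum (λ v → χ U v * g v)
      ≡⟨ sum-cong-≗ (λ v → trans (cong (_* g v) (χ-split v)) (*-distribʳ-+ (g v) (χ rest v) _)) ⟩
    sum (λ v → χ rest v * g v + sum (λ i → ⟦ vertex Q i ≟ v ⟧) * g v)
      ≡⟨ ∑-distrib-+ (λ v → χ rest v * g v) (λ v → sum (λ i → ⟦ vertex Q i ≟ v ⟧) * g v) ⟩
    sum (λ v → χ rest v * g v) + sum (λ v → sum (λ i → ⟦ vertex Q i ≟ v ⟧) * g v)
      ≡⟨ cong (sum (λ v → χ rest v * g v) +_) (begin
        sum (λ v → sum (λ i → ⟦ vertex Q i ≟ v ⟧) * g v)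
          ≡⟨ sum-cong-≗ (λ v → *-distribʳ-sum (g v) (λ i → ⟦ vertex Q i ≟ v ⟧)) ⟩
        sum (λ v → sum (λ i → ⟦ vertex Q i ≟ v ⟧ * g v))
          ≡⟨ ∑-comm (λ v i → ⟦ vertex Q i ≟ v ⟧ * g v) ⟩
        sum (λ i → sum (λ v → ⟦ vertex Q i ≟ v ⟧ * g v))
          ≡⟨ sum-cong-≗ (λ i → sum-δ (vertex Q i) g) ⟩
        sum (λ i → g (vertex Q i)) ∎) ⟩
    sum (λ v → χ rest v * g v) + sum (λ i → g (vertex Q i)) ∎
    where open ≡-Reasoning

  crossing : ℕ
  crossing = sum (λ u → χ rest u * codegree Q u)

  -- Pairs between Q and the rest occur in both orders, hence twice `crossing`; inside Q only the k
  -- loops are nonadjacent.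
  nonadjacencies-split : nonadjacencies G U ≡ nonadjacencies G rest + (crossing + crossing) + k
  nonadjacencies-split = begin
    nonadjacencies G U
      ≡⟨ sum-split (λ u → sum (λ v → χ U v * A̅ G u v)) ⟩
    sum (λ u → χ rest u * sum (λ v → χ U v * A̅ G u v)) + sum (λ i → sum (λ v → χ U v * A̅ G (vertex Q i) v))
      ≡⟨ cong₂ _+_ outer inner ⟩
    nonadjacencies G rest + crossing + (crossing + k)
      ≡⟨ solve (nonadjacencies G rest) crossing k ⟩
    nonadjacencies G rest + (crossing + crossing) + k ∎
    where
    open ≡-Reasoning
    solve : ∀ a b c → a + b + (b + c) ≡ a + (b + b) + c
    solve = solve-∀
    outer : sum (λ u → χ rest u * sum (λ v → χ U v * A̅ G u v)) ≡ nonadjacencies G rest + crossing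
    outer = trans (sum-cong-≗ λ u → trans (cong (χ rest u *_) (sum-split (A̅ G u)))
                                          (*-distribˡ-+ (χ rest u) _ _))
                  (∑-distrib-+ (λ u → χ rest u * sum (λ v → χ rest v * A̅ G u v)) _)
    inner : sum (λ i → sum (λ v → χ U v * A̅ G (vertex Q i) v)) ≡ crossing + k
    inner = begin
      sum (λ i → sum (λ v → χ U v * A̅ G (vertex Q i) v))
        ≡⟨ sum-cong-≗ (λ i → trans (sum-split (A̅ G (vertex Q i)))
                                   (cong (sum (λ v → χ rest v * A̅ G (vertex Q i) v) +_) (codegree-vertex Q i))) ⟩
      sum (λ i → sum (λ v → χ rest v * A̅ G (vertex Q i) v) + 1)
        ≡⟨ ∑-distrib-+ (λ i → sum (λ v → χ rest v * A̅ G (vertex Q i) v)) (λ _ → 1) ⟩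
      sum (λ i → sum (λ v → χ rest v * A̅ G (vertex Q i) v)) + sum {k} (λ _ → 1)
        ≡⟨ cong₂ _+_ (∑-comm (λ i v → χ rest v * A̅ G (vertex Q i) v)) (trans (sum-const k 1) (*-identityʳ k)) ⟩
      sum (λ v → sum (λ i → χ rest v * A̅ G (vertex Q i) v)) + k
        ≡⟨ cong (_+ k) (sum-cong-≗ λ v → trans
             (sum-cong-≗ λ i → cong (χ rest v *_) (A̅-sym G (vertex Q i) v))
             (sym (*-distribˡ-sum (χ rest v) (λ i → A̅ G v (vertex Q i))))) ⟩
      crossing + k ∎

  rest≤crossing-pointwise : ¬ Clique G (_∈ U) (suc k) → ∀ u → χ rest u ≤ χ rest u * codegree Q u
  rest≤crossing-pointwise free u with u ∈? rest
  ... | no _   = z≤n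
  ... | yes u∈ = ≤-trans (codegree≥1 Q free (rest⊆U u∈)) (≤-reflexive (sym (*-identityˡ _)))

m*n≤o⇒m≤o/n : ∀ m n o .{{_ : NonZero n}} → m * n ≤ o → m ≤ o ℕ./ n
m*n≤o⇒m≤o/n m n o mn≤o = subst (_≤ o ℕ./ n) (m*n/n≡m m n) (/-monoˡ-≤ n mn≤o)

-- Chord inequalities and balanced sizes

Near : ℕ → ℕ → Set
Near k a = a ≡ k ⊎ a ≡ suc k

near : ∀ {k a} → k ≤ a → a ≤ suc k → Near k a
near k≤a a≤1+k with m≤n⇒m<n∨m≡n k≤a
... | inj₁ k<a = inj₂ (≤-antisym a≤1+k k<a)
... | inj₂ k≡a = inj₁ (sym k≡a)

near-∣-∣ : ∀ {k a b} → Near k a → Near k b → ∣ a - b ∣ ≤ 1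
near-∣-∣ {k} (inj₁ refl) (inj₁ refl) = ≤-trans (≤-reflexive (m≡n⇒∣m-n∣≡0 {k} refl)) z≤n
near-∣-∣ {k} (inj₁ refl) (inj₂ refl) = ≤-reflexive (trans (cong ∣ k -_∣ (+-comm 1 k)) (∣m-m+n∣≡n k 1))
near-∣-∣ {k} (inj₂ refl) (inj₁ refl) = ≤-reflexive (trans (∣-∣-comm (suc k) k) (trans (cong ∣ k -_∣ (+-comm 1 k)) (∣m-m+n∣≡n k 1)))
near-∣-∣ {k} (inj₂ refl) (inj₂ refl) = ≤-trans (≤-reflexive (m≡n⇒∣m-n∣≡0 {k} refl)) z≤n

-- The chord of the parabola between k and suc k lies below it at every other natural number.
chord : ∀ k a → ∃ λ d → (1 + (k + k)) * a + (d + d * d) ≡ a * a + k * (k + 1) × (d ≡ 0 → Near k a)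
chord k a with a ≤? k
... | yes a≤k with m≤n⇒∃[o]m+o≡n a≤k
...   | d , refl = d , identity a d , λ { refl → inj₁ (sym (+-identityʳ a)) }
  where
  identity : ∀ a d → (1 + ((a + d) + (a + d))) * a + (d + d * d) ≡ a * a + (a + d) * ((a + d) + 1)
  identity = solve-∀
chord k a | no a≰k with m≤n⇒∃[o]m+o≡n (≰⇒> a≰k)
...   | d , refl = d , identity k d , λ { refl → inj₂ (cong suc (+-identityʳ k)) }
  where
  identity : ∀ k d → (1 + (k + k)) * (suc k + d) + (d + d * d) ≡ (suc k + d) * (suc k + d) + k * (k + 1)
  identity = solve-∀

chord-≤ : ∀ k a → (1 + (k + k)) * a ≤ a * a + k * (k + 1)
chord-≤ k a with chord k a
... | d , eq , _ = ≤-trans (m≤m+n _ _) (≤-reflexive eq)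

chord-tight : ∀ k a → a * a + k * (k + 1) ≤ (1 + (k + k)) * a → Near k a
chord-tight k a tight with chord k a
... | d , eq , d≡0⇒near = d≡0⇒near (m+n≡0⇒m≡0 d (n≤0⇒n≡0 (+-cancelˡ-≤ ((1 + (k + k)) * a) _ _
        (≤-trans (≤-reflexive eq) (≤-trans tight (≤-reflexive (sym (+-identityʳ _))))))))

chord-near : ∀ {k a} → Near k a → (1 + (k + k)) * a ≡ a * a + k * (k + 1)
chord-near {k} (inj₁ refl) = identity k
  where
  identity : ∀ k → (1 + (k + k)) * k ≡ k * k + k * (k + 1)
  identity = solve-∀
chord-near {k} (inj₂ refl) = identity k
  where
  identity : ∀ k → (1 + (k + k)) * suc k ≡ suc k * suc k + k * (k + 1)
  identity = solve-∀

module _ {r} (f : Fin r → ℕ) where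

  size squares : Subset r → ℕ
  size    S = sum (λ i → χ S i * f i)
  squares S = sum (λ i → χ S i * (f i * f i))

  private
    sum-chord : ∀ k S → sum (λ i → χ S i * ((1 + (k + k)) * f i)) ≡ (1 + (k + k)) * size S
    sum-chord k S = trans (sum-cong-≗ λ i → swap (χ S i) (1 + (k + k)) (f i))
                          (sym (*-distribˡ-sum (1 + (k + k)) (λ i → χ S i * f i)))
      where
      swap : ∀ a b c → a * (b * c) ≡ b * (a * c)
      swap = solve-∀

    sum-parabola : ∀ k S → sum (λ i → χ S i * (f i * f i + k * (k + 1))) ≡ squares S + ∣ S ∣ * (k * (k + 1))
    sum-parabola k S = begin
      sum (λ i → χ S i * (f i * f i + k * (k + 1)))
        ≡⟨ sum-cong-≗ (λ i → *-distribˡ-+ (χ S i) (f i * f i) (k * (k + 1))) ⟩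
      sum (λ i → χ S i * (f i * f i) + χ S i * (k * (k + 1)))
        ≡⟨ ∑-distrib-+ (λ i → χ S i * (f i * f i)) (λ i → χ S i * (k * (k + 1))) ⟩
      squares S + sum (λ i → χ S i * (k * (k + 1)))
        ≡⟨ cong (squares S +_) (sym (*-distribʳ-sum (k * (k + 1)) (χ S))) ⟩
      squares S + sum (χ S) * (k * (k + 1))
        ≡⟨ cong (λ c → squares S + c * (k * (k + 1))) (∣p∣≡sum-χ S) ⟨
      squares S + ∣ S ∣ * (k * (k + 1)) ∎
      where open ≡-Reasoning

  squares-≥ : ∀ k S → (1 + (k + k)) * size S ≤ squares S + ∣ S ∣ * (k * (k + 1))
  squares-≥ k S = subst₂ _≤_ (sum-chord k S) (sum-parabola k S)
    (sum-mono-≤ λ i → *-monoʳ-≤ (χ S i) (chord-≤ k (f i)))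

  -- Tightness of the sum makes every chord inequality over S an equality, and a chord meets the
  -- parabola only at its two ends.
  squares-tight : ∀ k S → squares S + ∣ S ∣ * (k * (k + 1)) ≤ (1 + (k + k)) * size S →
                  ∀ i → i ∈ S → Near k (f i)
  squares-tight k S tight i i∈S = chord-tight k (f i) (subst₂ _≤_ (drop _) (drop _)
    (sum-tight (λ i → *-monoʳ-≤ (χ S i) (chord-≤ k (f i)))
               (subst₂ _≤_ (sym (sum-parabola k S)) (sym (sum-chord k S)) tight) i))
    where
    drop : ∀ x → χ S i * x ≡ x
    drop x = trans (cong (_* x) (⟦⟧-true (i ∈? S) i∈S)) (*-identityˡ x)

  squares-near : ∀ k S → (∀ i → i ∈ S → Near k (f i)) →
                 (1 + (k + k)) * size S ≡ squares S + ∣ S ∣ * (k * (k + 1))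
  squares-near k S near = trans (sym (sum-chord k S)) (trans (sum-cong-≗ pointwise) (sum-parabola k S))
    where
    pointwise : ∀ i → χ S i * ((1 + (k + k)) * f i) ≡ χ S i * (f i * f i + k * (k + 1))
    pointwise i with i ∈? S
    ... | yes i∈S = cong (1 *_) (chord-near (near i i∈S))
    ... | no _    = refl

  -- All sizes are at most f i + 1, and the one at i is strictly smaller, so the average is below f
  -- i + 1. All sizes are at least f i - 1, so the average is at least that. Hence the floor of the
  -- average is f i or f i - 1.
  balanced⇒near : ∀ S m .{{_ : NonZero ∣ S ∣}} → size S ≡ m →
                  (∀ i j → i ∈ S → j ∈ S → ∣ f i - f j ∣ ≤ 1) →
                  ∀ i → i ∈ S → Near (m ℕ./ ∣ S ∣) (f i)
  balanced⇒near S m refl balanced i i∈S = near (s≤s⁻¹ (m<n*o⇒m/o<n {m} {suc (f i)} {∣ S ∣} upper)) (lower (f i) refl)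
    where
    open ≤-Reasoning
    const-size : ∀ c → sum (λ j → χ S j * c) ≡ c * ∣ S ∣
    const-size c = trans (sym (*-distribʳ-sum c (χ S)))
                         (trans (cong (_* c) (sym (∣p∣≡sum-χ S))) (*-comm ∣ S ∣ c))
    close : ∀ j → j ∈ S → f j ≤ suc (f i)
    close j j∈S = ≤-trans (m≤n+∣m-n∣ (f j) (f i))
      (≤-trans (+-monoʳ-≤ (f i) (balanced j i j∈S i∈S)) (≤-reflexive (+-comm (f i) 1)))
    upper : size S < suc (f i) * ∣ S ∣
    upper = begin
      suc (size S)                            ≡⟨ +-comm 1 _ ⟩
      -- The extra 1 is charged to the index i, where f i falls short of f i + 1.
      size S + 1                              ≡⟨ cong (size S +_) (sum-δ₁ i) ⟨
      size S + sum (λ j → ⟦ i ≟ j ⟧)          ≡⟨ ∑-distrib-+ (λ j → χ S j * f j) (λ j → ⟦ i ≟ j ⟧) ⟨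
      sum (λ j → χ S j * f j + ⟦ i ≟ j ⟧)     ≤⟨ sum-mono-≤ pointwise ⟩
      sum (λ j → χ S j * suc (f i))           ≡⟨ const-size (suc (f i)) ⟩
      suc (f i) * ∣ S ∣                       ∎
      where
      pointwise : ∀ j → χ S j * f j + ⟦ i ≟ j ⟧ ≤ χ S j * suc (f i)
      pointwise j with j ∈? S | i ≟ j
      ... | no j∉S  | yes refl = contradiction i∈S j∉S
      ... | no _    | no _     = z≤n
      ... | yes _   | yes refl = ≤-reflexive (identity (f i))
        where
        identity : ∀ a → 1 * a + 1 ≡ 1 * suc a
        identity = solve-∀
      ... | yes j∈S | no _     = ≤-trans (≤-reflexive (+-identityʳ _)) (*-monoʳ-≤ 1 (close j j∈S))
    lower : ∀ a → f i ≡ a → a ≤ suc (size S ℕ./ ∣ S ∣)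
    lower zero    _     = z≤n
    lower (suc c) fi≡ = s≤s (m*n≤o⇒m≤o/n c ∣ S ∣ (size S) (begin
      c * ∣ S ∣                  ≡⟨ const-size c ⟨
      sum (λ j → χ S j * c)      ≤⟨ sum-mono-≤ pointwise ⟩
      size S                     ∎))
      where
      pointwise : ∀ j → χ S j * c ≤ χ S j * f j
      pointwise j with j ∈? S
      ... | no _    = z≤n
      ... | yes j∈S = *-monoʳ-≤ 1 (s≤s⁻¹ (begin
        suc c           ≡⟨ fi≡ ⟨
        f i             ≤⟨ m≤n+∣m-n∣ (f i) (f j) ⟩
        f j + ∣ f i - f j ∣ ≤⟨ +-monoʳ-≤ (f j) (balanced i j i∈S j∈S) ⟩
        f j + 1         ≡⟨ +-comm (f j) 1 ⟩
        suc (f j)       ∎))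

-- Complete multipartite graphs and Turán graphs

module _ {n r} (P : Fin n → Fin r) where

  partSize≡sum : ∀ i → partSize P i ≡ sum (λ v → ⟦ P v ≟ i ⟧)
  partSize≡sum i = ∣tabulate∣ (λ v → does (P v ≟ i))

  -- Double counting: each vertex is charged to the part that contains it.
  sum-parts : ∀ (g : Fin r → ℕ) → sum (λ i → g i * partSize P i) ≡ sum (λ v → g (P v))
  sum-parts g = begin
    sum (λ i → g i * partSize P i)
      ≡⟨ sum-cong-≗ (λ i → trans (cong (g i *_) (partSize≡sum i)) (*-distribˡ-sum (g i) (λ v → ⟦ P v ≟ i ⟧))) ⟩
    sum (λ i → sum (λ v → g i * ⟦ P v ≟ i ⟧))
      ≡⟨ ∑-comm (λ i v → g i * ⟦ P v ≟ i ⟧) ⟩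
    sum (λ v → sum (λ i → g i * ⟦ P v ≟ i ⟧))
      ≡⟨ sum-cong-≗ (λ v → trans (sum-cong-≗ λ i → *-comm (g i) ⟦ P v ≟ i ⟧) (sum-δ (P v) g)) ⟩
    sum (λ v → g (P v)) ∎
    where open ≡-Reasoning

  sum-partSize : sum (partSize P) ≡ n
  sum-partSize = begin
    sum (partSize P)                  ≡⟨ sum-cong-≗ (λ i → *-identityˡ (partSize P i)) ⟨
    sum (λ i → 1 * partSize P i)      ≡⟨ sum-parts (λ _ → 1) ⟩
    sum {n} (λ _ → 1)                 ≡⟨ trans (sum-const n 1) (*-identityʳ n) ⟩
    n                                 ∎
    where open ≡-Reasoning

  multipartite-nonadjacencies : ∀ {G} → IsCompleteMultipartite G P →
    nonadjacencies G ⊤ ≡ sum (λ i → partSize P i * partSize P i)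
  multipartite-nonadjacencies {G} (¬adj , adj) = begin
    nonadjacencies G ⊤                    ≡⟨ nonadjacencies-⊤ G ⟩
    sum (λ u → sum (λ v → A̅ G u v))       ≡⟨ sum-cong-≗ (λ u → sum-cong-≗ (same u)) ⟩
    sum (λ u → sum (λ v → ⟦ P v ≟ P u ⟧)) ≡⟨ sum-cong-≗ (λ u → partSize≡sum (P u)) ⟨
    sum (λ u → partSize P (P u))          ≡⟨ sum-parts (partSize P) ⟨
    sum (λ i → partSize P i * partSize P i) ∎
    where
    open ≡-Reasoning
    same : ∀ u v → A̅ G u v ≡ ⟦ P v ≟ P u ⟧
    same u v with P v ≟ P u
    ... | yes eq = A̅-¬Adj G (¬adj u v (sym eq))
    ... | no ≢ = ⟦⟧-false (¬? (adj? G u v)) (λ ¬uv → ¬uv (adj u v (≢ ∘ sym)))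

  totalSize≡size : ∀ S → sumˡ (map (partSize P) (filter (_∈? S) (allFin r))) ≡ size (partSize P) S
  totalSize≡size S = trans (sumˡ-filter (_∈? S) (partSize P) (allFin r))
                           (sumˡ-allFin (λ i → χ S i * partSize P i))

-- Induction on the number of vertices, one at a time. Admitting ρ = s makes the carry definitional,
-- since suc q * s reduces to s + q * s.
residue-count : ∀ s .{{_ : NonZero s}} q ρ → ρ ≤ s → ∀ j →
  let c = sum {ρ + q * s} (λ v → ⟦ toℕ v mod s ≟ j ⟧) in
  (toℕ j < ρ → c ≡ suc q) × (ρ ≤ toℕ j → c ≡ q)
residue-count s zero    zero    _   j = (λ ()) , (λ _ → refl)
residue-count s (suc q) zero    _   j = (λ ()) , (λ _ → proj₁ (residue-count s q s ≤-refl j) (toℕ<n j))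
residue-count s q       (suc ρ) ρ<s j = below , above
  where
  N = ρ + q * s
  last-residue : toℕ (N mod s) ≡ ρ
  last-residue = trans (toℕ-fromℕ< (m%n<n N s)) (trans ([m+kn]%n≡m%n ρ q s) (m<n⇒m%n≡m ρ<s))
  last-count : sum {suc N} (λ v → ⟦ toℕ v mod s ≟ j ⟧) ≡ sum {N} (λ v → ⟦ toℕ v mod s ≟ j ⟧) + ⟦ N mod s ≟ j ⟧
  last-count = trans (sum-init-last {N} (λ v → ⟦ toℕ v mod s ≟ j ⟧))
    (cong₂ _+_ (sum-cong-≗ {N} λ v → cong (λ x → ⟦ x mod s ≟ j ⟧) (toℕ-inject₁ v))
               (cong (λ x → ⟦ x mod s ≟ j ⟧) (toℕ-fromℕ N)))
  ih = residue-count s q ρ (<⇒≤ ρ<s) j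
  below : toℕ j < suc ρ → _
  below (s≤s j≤ρ) with m≤n⇒m<n∨m≡n j≤ρ
  ... | inj₁ j<ρ = trans last-count (trans (cong₂ _+_ (proj₁ ih j<ρ)
          (⟦⟧-false (N mod s ≟ j) λ eq → <-irrefl (trans (cong toℕ (sym eq)) last-residue) j<ρ)) (+-identityʳ _))
  ... | inj₂ j≡ρ = trans last-count (trans (cong₂ _+_ (proj₂ ih (≤-reflexive (sym j≡ρ)))
          (⟦⟧-true (N mod s ≟ j) (toℕ-injective (trans last-residue (sym j≡ρ))))) (+-comm q 1))
  above : suc ρ ≤ toℕ j → _
  above ρ<j = trans last-count (trans (cong₂ _+_ (proj₂ ih (<⇒≤ ρ<j))
          (⟦⟧-false (N mod s ≟ j) λ eq → <-irrefl (trans (sym last-residue) (cong toℕ eq)) ρ<j)) (+-identityʳ _))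

turán-near : ∀ s .{{_ : NonZero s}} m j → Near (m ℕ./ s) (partSize (λ (v : Fin m) → toℕ v mod s) j)
turán-near s m j = subst (Near (m ℕ./ s)) (sym (partSize≡sum (λ (v : Fin m) → toℕ v mod s) j))
  (subst (λ N → Near (m ℕ./ s) (sum {N} (λ v → ⟦ toℕ v mod s ≟ j ⟧))) (sym (m≡m%n+[m/n]*n m s)) count)
  where
  rc = residue-count s (m ℕ./ s) (m % s) (<⇒≤ (m%n<n m s)) j
  count : Near (m ℕ./ s) (sum {m % s + m ℕ./ s * s} (λ v → ⟦ toℕ v mod s ≟ j ⟧))
  count with toℕ j <? m % s
  ... | yes j<ρ = inj₂ (proj₁ rc j<ρ)
  ... | no  j≮ρ = inj₁ (proj₂ rc (≮⇒≥ j≮ρ))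

-- All part sizes are k or k+1, where the chord is exact. This replaces the Turán number by an
-- expression linear in m.
turán-nonadjacencies : ∀ s .{{_ : NonZero s}} m → let k = m ℕ./ s in
  nonadjacencies (turán s m) ⊤ + s * (k * (k + 1)) ≡ (1 + (k + k)) * m
turán-nonadjacencies s m = begin
  nonadjacencies (turán s m) ⊤ + s * (k * (k + 1))
    ≡⟨ cong₂ (λ x y → x + y * (k * (k + 1))) W≡ (sym (∣⊤∣≡n s)) ⟩
  squares f ⊤ + ∣ ⊤ {s} ∣ * (k * (k + 1))
    ≡⟨ squares-near f k ⊤ (λ i _ → turán-near s m i) ⟨
  (1 + (k + k)) * size f ⊤
    ≡⟨ cong ((1 + (k + k)) *_) (trans (sum-χ-⊤ f) (sum-partSize P)) ⟩
  (1 + (k + k)) * m ∎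
  where
  open ≡-Reasoning
  k = m ℕ./ s
  P : Fin m → Fin s
  P v = toℕ v mod s
  f = partSize P
  W≡ : nonadjacencies (turán s m) ⊤ ≡ squares f ⊤
  W≡ = trans (multipartite-nonadjacencies P {turán s m} ((λ _ _ eq ≢ → ≢ eq) , (λ _ _ ≢ → ≢)))
             (sym (sum-χ-⊤ (λ i → f i * f i)))

-- The weighted inequality over the integers

open import Data.Integer using (ℤ; +_; -[1+_]; 0ℤ; 1ℤ; +≤+) renaming (_≤_ to _≤ᶻ_)

-- weight k l ≤ Σ a² + penalty s t k l sums the chord inequalities (2k+1) a ≤ a² + k(k+1) over s parts
-- and those for l over t parts.  Integers are needed because the induction may take k and l below zero.
weight : ℤ → ℤ → ℤ → ℤ → ℤ
weight k l x y = (1ℤ ℤ.+ (k ℤ.+ k)) ℤ.* x ℤ.+ (1ℤ ℤ.+ (l ℤ.+ l)) ℤ.* y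

penalty : ℤ → ℤ → ℤ → ℤ → ℤ
penalty s t k l = s ℤ.* (k ℤ.* (k ℤ.+ 1ℤ)) ℤ.+ t ℤ.* (l ℤ.* (l ℤ.+ 1ℤ))

+-cancelʳ-≤ᶻ : ∀ c i j → i ℤ.+ c ℤ.≤ j ℤ.+ c → i ℤ.≤ j
+-cancelʳ-≤ᶻ c i j ic≤jc = subst₂ ℤ._≤_ (cancel i c) (cancel j c) (ℤ.+-monoˡ-≤ (ℤ.- c) ic≤jc)
  where
  cancel : ∀ i c → i ℤ.+ c ℤ.+ ℤ.- c ≡ i
  cancel = ℤ-solver.solve-∀

0≤i*j : ∀ {i j} → 0ℤ ℤ.≤ i → 0ℤ ℤ.≤ j → 0ℤ ℤ.≤ i ℤ.* j
0≤i*j {+ m} {+ n} _ _ = ℤ.≤-trans (+≤+ z≤n) (ℤ.≤-reflexive (ℤ.pos-* m n))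

0≤i*[i+1] : ∀ i → 0ℤ ℤ.≤ i ℤ.* (i ℤ.+ 1ℤ)
0≤i*[i+1] (+ n)           = 0≤i*j {+ n} {+ n ℤ.+ 1ℤ} (+≤+ z≤n) (+≤+ z≤n)
0≤i*[i+1] -[1+ zero ]     = +≤+ z≤n
0≤i*[i+1] -[1+ suc n ]    = +≤+ z≤n

-- The coefficients are products of two consecutive integers, hence nonnegative even for negative k
-- and l. This permits lowering s or t when there is no clique of full size.
penalty-mono : ∀ {s s′ t t′} k l → s ≤ s′ → t ≤ t′ →
               penalty (+ s) (+ t) k l ℤ.≤ penalty (+ s′) (+ t′) k l
penalty-mono k l s≤s′ t≤t′ = ℤ.+-mono-≤
  (ℤ.*-monoʳ-≤-nonNeg _ {{ℤ.nonNegative (0≤i*[i+1] k)}} (+≤+ s≤s′))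
  (ℤ.*-monoʳ-≤-nonNeg _ {{ℤ.nonNegative (0≤i*[i+1] l)}} (+≤+ t≤t′))

-- The weight rises by 2(x+y) + (2k+1)p + (2l+1)q and the penalty by 2ks + 2lt. Since p + q = s + t,
-- the right side rises by 2(k-l)(s-p) more than the left.
weight-step : ∀ k l s t x y p q W → l ℤ.≤ k → p ℤ.≤ s → p ℤ.+ q ≡ s ℤ.+ t →
  weight (k ℤ.- 1ℤ) (l ℤ.- 1ℤ) x y ℤ.≤ W ℤ.+ penalty s t (k ℤ.- 1ℤ) (l ℤ.- 1ℤ) →
  weight k l (x ℤ.+ p) (y ℤ.+ q) ℤ.≤ W ℤ.+ ((x ℤ.+ y) ℤ.+ (x ℤ.+ y)) ℤ.+ (s ℤ.+ t) ℤ.+ penalty s t k l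
weight-step k l s t x y p q W l≤k p≤s p+q≡s+t ih = ℤ.0≤i-j⇒j≤i
  (ℤ.≤-trans (ℤ.+-mono-≤ (ℤ.i≤j⇒0≤j-i ih) (ℤ.+-mono-≤ 0≤κσ 0≤κσ))
             (ℤ.≤-reflexive (trans (identity k l s t x y p W) (cong gap (sym q≡)))))
  where
  gap : ℤ → ℤ
  gap q = W ℤ.+ ((x ℤ.+ y) ℤ.+ (x ℤ.+ y)) ℤ.+ (s ℤ.+ t) ℤ.+ penalty s t k l ℤ.- weight k l (x ℤ.+ p) (y ℤ.+ q)
  q≡ : q ≡ s ℤ.+ t ℤ.- p
  q≡ = trans (cancel p q) (cong (ℤ._- p) p+q≡s+t)
    where
    cancel : ∀ p q → q ≡ p ℤ.+ q ℤ.- p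
    cancel = ℤ-solver.solve-∀
  0≤κσ : 0ℤ ℤ.≤ (k ℤ.- l) ℤ.* (s ℤ.- p)
  0≤κσ = 0≤i*j (ℤ.i≤j⇒0≤j-i l≤k) (ℤ.i≤j⇒0≤j-i p≤s)
  identity : ∀ k l s t x y p W →
    (W ℤ.+ (s ℤ.* ((k ℤ.- 1ℤ) ℤ.* ((k ℤ.- 1ℤ) ℤ.+ 1ℤ)) ℤ.+ t ℤ.* ((l ℤ.- 1ℤ) ℤ.* ((l ℤ.- 1ℤ) ℤ.+ 1ℤ)))
      ℤ.- ((1ℤ ℤ.+ ((k ℤ.- 1ℤ) ℤ.+ (k ℤ.- 1ℤ))) ℤ.* x ℤ.+ (1ℤ ℤ.+ ((l ℤ.- 1ℤ) ℤ.+ (l ℤ.- 1ℤ))) ℤ.* y))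
    ℤ.+ ((k ℤ.- l) ℤ.* (s ℤ.- p) ℤ.+ (k ℤ.- l) ℤ.* (s ℤ.- p))
    ≡ W ℤ.+ ((x ℤ.+ y) ℤ.+ (x ℤ.+ y)) ℤ.+ (s ℤ.+ t)
      ℤ.+ (s ℤ.* (k ℤ.* (k ℤ.+ 1ℤ)) ℤ.+ t ℤ.* (l ℤ.* (l ℤ.+ 1ℤ)))
      ℤ.- ((1ℤ ℤ.+ (k ℤ.+ k)) ℤ.* (x ℤ.+ p) ℤ.+ (1ℤ ℤ.+ (l ℤ.+ l)) ℤ.* (y ℤ.+ (s ℤ.+ t ℤ.- p)))
  identity = ℤ-solver.solve-∀

-- Recovering the parts from unique nonneighbours

-- Swapping a vertex into the clique Q shows that nonadjacent vertices have the same nonneighbour in Q.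
unique-nonneighbours⇒multipartite : ∀ {n r} (G : Graph (Fin n)) → Clique G (_∈ ⊤) r →
  ¬ Clique G (_∈ ⊤) (suc r) → (∀ (Q : Clique G (_∈ ⊤) r) u → codegree Q u ≤ 1) →
  Σ (Fin n → Fin r) (IsCompleteMultipartite G)
unique-nonneighbours⇒multipartite {n} {r} G Q free codegree≤1 = φ , same⇒¬adj , different⇒adj
  where
  φ : Fin n → Fin r
  φ u = proj₁ (nonneighbour Q free {u} ∈⊤)
  unique : ∀ (Q : Clique G (_∈ ⊤) r) u i j →
           ¬ Adj G u (vertex Q i) → ¬ Adj G u (vertex Q j) → i ≡ j
  unique Q u i j ¬ui ¬uj =
    sum≤1⇒unique (λ i → A̅ G u (vertex Q i)) (codegree≤1 Q u) i j (A̅-¬Adj G ¬ui) (A̅-¬Adj G ¬uj)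
  adj-vertex : ∀ u j → j ≢ φ u → Adj G u (vertex Q j)
  adj-vertex u j j≢φu with adj? G u (vertex Q j)
  ... | yes uj = uj
  ... | no ¬uj = contradiction (unique Q u j (φ u) ¬uj (proj₂ (nonneighbour Q free ∈⊤))) j≢φu
  swap : ∀ u → Σ (Clique G (_∈ ⊤) r) λ Q′ →
         vertex Q′ (φ u) ≡ u × (∀ j → j ≢ φ u → vertex Q′ j ≡ vertex Q j)
  swap u = replace Q (φ u) ∈⊤ (adj-vertex u)
  -- Outside the common index, v is adjacent to all of Q; an edge uv would therefore extend the
  -- clique in which u has been swapped in.
  same⇒¬adj : ∀ u v → φ u ≡ φ v → ¬ Adj G u v
  same⇒¬adj u v φu≡φv uv with swap u
  ... | Q′ , at , off = free (extend Q′ {v} ∈⊤ v~Q′)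
    where
    v~Q′ : ∀ i → Adj G v (vertex Q′ i)
    v~Q′ i with i ≟ φ u
    ... | yes refl rewrite at = symm G uv
    ... | no i≢φu rewrite off i i≢φu = adj-vertex v i (λ i≡φv → i≢φu (trans i≡φv (sym φu≡φv)))
  different⇒adj : ∀ u v → φ u ≢ φ v → Adj G u v
  different⇒adj u v φu≢φv with adj? G u v
  ... | yes uv = uv
  ... | no ¬uv with swap u
  ...   | Q′ , at , off = contradiction
    (unique Q′ v (φ u) (φ v) (λ v~ → ¬uv (symm G (subst (Adj G v) at v~)))
      (λ v~ → proj₂ (nonneighbour Q free {v} ∈⊤) (subst (Adj G v) (off (φ v) (φu≢φv ∘ sym)) v~)))
    φu≢φv

-- Parts may be empty, so surplus labels do no harm. This undoes the lowering of r.
relabel : ∀ {n r r′} {G : Graph (Fin n)} → r ≤ r′ → Σ (Fin n → Fin r) (IsCompleteMultipartite G) →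
          Σ (Fin n → Fin r′) (IsCompleteMultipartite G)
relabel r≤r′ (P , ¬adj , adj) =
  (λ v → inject≤ (P v) r≤r′) ,
  (λ u v eq → ¬adj u v (inject≤-injective r≤r′ r≤r′ _ _ eq)) ,
  (λ u v ≢ → adj u v λ eq → ≢ (cong (λ i → inject≤ i r≤r′) eq))

-- The induction and its case of equality

module _ {n} (G : Graph (Fin n)) (M : Subset n) where

  in-M out-M : Subset n → ℕ
  in-M  U = sum (λ v → χ U v * χ M v)
  out-M U = sum (λ v → χ U v * χ (∁ M) v)

  in+out : ∀ U → in-M U + out-M U ≡ sum (χ U)
  in+out U = trans (sym (∑-distrib-+ (λ v → χ U v * χ M v) (λ v → χ U v * χ (∁ M) v)))
                   (sum-cong-≗ λ v → trans (sym (*-distribˡ-+ (χ U v) _ _))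
                                           (trans (cong (χ U v *_) (χ-∁ M v)) (*-identityʳ _)))

  -- The invariant of the induction, with r = s + t. Only the vertex set U shrinks; the graph and M
  -- stay fixed.
  FreeWithin : Subset n → ℕ → ℕ → Set
  FreeWithin U s t = ¬ Clique G (_∈ U) (suc (s + t)) × ¬ Clique G (λ v → v ∈ U × v ∈ M) (suc s)

  -- The count w is a parameter because the case of equality also needs the bound with 2|rest| in
  -- place of the crossing pairs.
  Bound : ℤ → ℤ → ℕ → ℕ → Subset n → ℕ → Set
  Bound k l s t U w = weight k l (+ in-M U) (+ out-M U) ℤ.≤ + w ℤ.+ penalty (+ s) (+ t) k l

  shrinkʳ : ∀ {U} s t → ¬ Clique G (_∈ U) (s + suc t) → FreeWithin U s (suc t) → FreeWithin U s t
  shrinkʳ {U} s t none (_ , freeM) = (λ Q → none (subst (Clique G (_∈ U)) (sym (+-suc s t)) Q)) , freeM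

  -- With t = 0 it is s that must drop. The condition on M survives because even U has no clique of
  -- size s + 1.
  shrinkˡ : ∀ {U} s → ¬ Clique G (_∈ U) (suc s + 0) → FreeWithin U (suc s) 0 → FreeWithin U s 0
  shrinkˡ {U} s none _ =
    none , λ Q → none (subst (Clique G (_∈ U)) (cong suc (sym (+-identityʳ s))) (weaken proj₁ Q))

  module _ {U s t} (Q : Clique G (_∈ U) (s + t)) (free : FreeWithin U s t) where
    open Removal Q

    rest-free : FreeWithin rest s t
    rest-free = proj₁ free ∘ weaken rest⊆U , proj₂ free ∘ weaken (λ (r , m) → rest⊆U r , m)

    remove-clique : ∀ {k l} → l ℤ.≤ k → Bound (k ℤ.- 1ℤ) (l ℤ.- 1ℤ) s t rest (nonadjacencies G rest) →
                    Bound k l s t U (nonadjacencies G rest + (sum (χ rest) + sum (χ rest)) + (s + t))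
    remove-clique {k} {l} l≤k ih = begin
      weight k l (+ in-M U) (+ out-M U)
        ≡⟨ cong₂ (λ x y → weight k l (+ x) (+ y)) (sum-split (χ M)) (sum-split (χ (∁ M))) ⟩
      weight k l (+ (in-M rest + p)) (+ (out-M rest + q))
        ≤⟨ weight-step k l (+ s) (+ t) (+ in-M rest) (+ out-M rest) (+ p) (+ q) (+ nonadjacencies G rest)
             l≤k (+≤+ p≤s) (cong +_ p+q≡s+t) ih ⟩
      + (nonadjacencies G rest + ((in-M rest + out-M rest) + (in-M rest + out-M rest)) + (s + t))
        ℤ.+ penalty (+ s) (+ t) k l
        ≡⟨ cong (λ m → + (nonadjacencies G rest + (m + m) + (s + t)) ℤ.+ penalty (+ s) (+ t) k l) (in+out rest) ⟩
      + (nonadjacencies G rest + (sum (χ rest) + sum (χ rest)) + (s + t)) ℤ.+ penalty (+ s) (+ t) k l ∎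
      where
      open ℤ.≤-Reasoning
      p q : ℕ
      p = sum (λ i → χ M (vertex Q i))
      q = sum (λ i → χ (∁ M) (vertex Q i))
      p+q≡s+t : p + q ≡ s + t
      p+q≡s+t = trans (sym (∑-distrib-+ (χ M ∘ vertex Q) (χ (∁ M) ∘ vertex Q)))
                (trans (sum-cong-≗ (λ i → χ-∁ M (vertex Q i)))
                       (trans (sum-const (s + t) 1) (*-identityʳ _)))
      -- More than s vertices of Q in M would contain a clique of size s + 1 inside M.
      p≤s : p ≤ s
      p≤s = ≮⇒≥ λ s<p → let h , h∈M , h≢ = pick-distinct (λ i → vertex Q i ∈? M) (suc s) s<p in
        proj₂ free (subclique Q h (λ i → member Q (h i) , h∈M i) h≢)

    rest≤crossing : sum (χ rest) ≤ crossing
    rest≤crossing = sum-mono-≤ (rest≤crossing-pointwise (proj₁ free))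

    bound-step : ∀ {k l} → l ℤ.≤ k → Bound (k ℤ.- 1ℤ) (l ℤ.- 1ℤ) s t rest (nonadjacencies G rest) →
                 Bound k l s t U (nonadjacencies G U)
    bound-step {k} {l} l≤k ih = ℤ.≤-trans (remove-clique l≤k ih) (ℤ.+-monoˡ-≤ (penalty (+ s) (+ t) k l) (+≤+
      (≤-trans (+-monoˡ-≤ (s + t) (+-monoʳ-≤ (nonadjacencies G rest) (+-mono-≤ rest≤crossing rest≤crossing)))
               (≤-reflexive (sym nonadjacencies-split)))))

    rest-smaller : ∀ {N} → 0 < s + t → sum (χ U) < suc N → sum (χ rest) < N
    rest-smaller {N} 0<s+t (s≤s ≤N) = begin
      suc (sum (χ rest))         ≡⟨ +-comm 1 _ ⟩
      sum (χ rest) + 1           ≤⟨ +-monoʳ-≤ _ 0<s+t ⟩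
      sum (χ rest) + (s + t)     ≡⟨ cong (λ r → sum (χ rest) + r) (trans (sum-const (s + t) 1) (*-identityʳ _)) ⟨
      sum (χ rest) + sum {s + t} (λ _ → 1)
        ≡⟨ cong (_+ sum {s + t} (λ _ → 1)) (sum-cong-≗ (λ v → *-identityʳ (χ rest v))) ⟨
      sum (λ v → χ rest v * 1) + sum {s + t} (λ _ → 1)
        ≡⟨ sum-split (λ _ → 1) ⟨
      sum (λ v → χ U v * 1)      ≡⟨ sum-cong-≗ (λ v → *-identityʳ (χ U v)) ⟩
      sum (χ U)                  ≤⟨ ≤N ⟩
      N                          ∎
      where open ≤-Reasoning

  -- The number N exceeds |U| and drops when a clique is deleted; otherwise t drops, and then s once
  -- t is 0. Subtracting 1 from both k and l preserves l ≤ k. For s = t = 0 there is no clique of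
  -- size 1, so U is empty.
  nonadjacencies-bound : ∀ N s t {k l} U → l ℤ.≤ k → sum (χ U) < N → FreeWithin U s t →
                         Bound k l s t U (nonadjacencies G U)
  nonadjacencies-bound (suc N) zero zero {k} {l} U l≤k _ (free , _) = begin
    weight k l (+ in-M U) (+ out-M U)
      ≡⟨ cong₂ (λ x y → weight k l (+ x) (+ y)) (empty (χ M)) (empty (χ (∁ M))) ⟩
    weight k l 0ℤ 0ℤ
      ≡⟨ cong₂ ℤ._+_ (ℤ.*-zeroʳ (1ℤ ℤ.+ (k ℤ.+ k))) (ℤ.*-zeroʳ (1ℤ ℤ.+ (l ℤ.+ l))) ⟩
    0ℤ
      ≤⟨ +≤+ z≤n ⟩
    + nonadjacencies G U ℤ.+ penalty 0ℤ 0ℤ k l ∎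
    where
    open ℤ.≤-Reasoning
    empty : ∀ f → sum (λ v → χ U v * f v) ≡ 0
    empty f = sum-zero {n} _ λ v → cong (_* f v) (⟦⟧-false (v ∈? U) λ v∈ →
      free (clique (λ _ → v) (λ _ → v∈) λ { zero zero i≢i → contradiction refl i≢i }))
  nonadjacencies-bound (suc N) (suc s) zero {k} {l} U l≤k ≤N free with clique? G U (suc s + 0)
  ... | no none = ℤ.≤-trans (nonadjacencies-bound (suc N) s 0 U l≤k ≤N (shrinkˡ s none free))
                            (ℤ.+-monoʳ-≤ (+ nonadjacencies G U) (penalty-mono {t = 0} {0} k l (n≤1+n s) z≤n))
  ... | yes Q   = bound-step Q free l≤k (nonadjacencies-bound N (suc s) zero _ (ℤ.+-monoˡ-≤ _ l≤k)
                    (rest-smaller Q free (s≤s z≤n) ≤N) (rest-free Q free))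
  nonadjacencies-bound (suc N) s (suc t) {k} {l} U l≤k ≤N free with clique? G U (s + suc t)
  ... | no none = ℤ.≤-trans (nonadjacencies-bound (suc N) s t U l≤k ≤N (shrinkʳ s t none free))
                            (ℤ.+-monoʳ-≤ (+ nonadjacencies G U) (penalty-mono {s} k l ≤-refl (n≤1+n t)))
  ... | yes Q   = bound-step Q free l≤k (nonadjacencies-bound N s (suc t) _ (ℤ.+-monoˡ-≤ _ l≤k)
                    (rest-smaller Q free (≤-trans (s≤s z≤n) (m≤n+m (suc t) s)) ≤N) (rest-free Q free))

  Tight : ℤ → ℤ → ℕ → ℕ → Set
  Tight k l s t = + nonadjacencies G ⊤ ℤ.+ penalty (+ s) (+ t) k l ℤ.≤ weight k l (+ in-M ⊤) (+ out-M ⊤)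

  -- The bound for the remaining vertices gives W ≤ W(rest) + 2|rest| + r, while exactly W = W(rest)
  -- + 2 crossing + r. So crossing ≤ |rest|, and no term can exceed the 1 that each vertex
  -- contributes at least.
  tight⇒codegree≤1 : ∀ {s t k l} → l ℤ.≤ k → FreeWithin ⊤ s t → Tight k l s t →
                     ∀ (Q : Clique G (_∈ ⊤) (s + t)) u → codegree Q u ≤ 1
  tight⇒codegree≤1 {s} {t} {k} {l} l≤k free tight Q u with any? (λ i → vertex Q i ≟ u)
  ... | yes (i , refl) = ≤-reflexive (codegree-vertex Q i)
  ... | no ∄i = begin
    codegree Q u              ≡⟨ *-identityˡ _ ⟨
    1 * codegree Q u          ≡⟨ cong (_* codegree Q u) χ≡1 ⟨
    χ rest u * codegree Q u   ≤⟨ sum-tight (rest≤crossing-pointwise (proj₁ free)) crossing≤rest u ⟩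
    χ rest u                  ≡⟨ χ≡1 ⟩
    1                         ∎
    where
    open ≤-Reasoning
    open Removal Q
    χ≡1 : χ rest u ≡ 1
    χ≡1 = ⟦⟧-true (u ∈? rest) (∈-tabulate⁺ remains? (∈⊤ , ∄i))
    W R : ℕ
    W = nonadjacencies G rest
    R = sum (χ rest)
    W≤ : + nonadjacencies G ⊤ ℤ.≤ + (W + (R + R) + (s + t))
    W≤ = +-cancelʳ-≤ᶻ (penalty (+ s) (+ t) k l) _ _ (ℤ.≤-trans tight (remove-clique Q free l≤k
           (nonadjacencies-bound (suc R) s t rest (ℤ.+-monoˡ-≤ _ l≤k) ≤-refl (rest-free Q free))))
    crossing≤rest : crossing ≤ R
    crossing≤rest = +-tightˡ (rest≤crossing Q free) (rest≤crossing Q free)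
      (+-cancelˡ-≤ W _ _ (+-cancelʳ-≤ (s + t) _ _
        (≤-trans (≤-reflexive (sym nonadjacencies-split)) (ℤ.drop‿+≤+ W≤))))

  -- If there is no clique of size s + t, tightness passes to the smaller parameters because their
  -- penalty is no larger.
  tight⇒multipartite : ∀ s t {k l} → l ℤ.≤ k → FreeWithin ⊤ s t → Tight k l s t →
                       Σ (Fin n → Fin (s + t)) (IsCompleteMultipartite G)
  tight⇒multipartite s t l≤k free tight with clique? G ⊤ (s + t)
  tight⇒multipartite s t l≤k free tight | yes Q =
    unique-nonneighbours⇒multipartite G Q (proj₁ free) (tight⇒codegree≤1 {s} {t} l≤k free tight)
  tight⇒multipartite zero zero l≤k free tight | no none =
    contradiction (clique (λ ()) (λ ()) (λ ())) none
  tight⇒multipartite (suc s) zero {k} {l} l≤k free tight | no none =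
    relabel {G = G} (n≤1+n _) (tight⇒multipartite s zero l≤k (shrinkˡ s none free)
      (ℤ.≤-trans (ℤ.+-monoʳ-≤ (+ nonadjacencies G ⊤) (penalty-mono {t = 0} {0} k l (n≤1+n s) z≤n)) tight))
  tight⇒multipartite s (suc t) {k} {l} l≤k free tight | no none =
    relabel {G = G} (+-monoʳ-≤ s (n≤1+n t)) (tight⇒multipartite s t l≤k (shrinkʳ s t none free)
      (ℤ.≤-trans (ℤ.+-monoʳ-≤ (+ nonadjacencies G ⊤) (penalty-mono {s} k l ≤-refl (n≤1+n t))) tight))

-- From |M| to m

weightℕ : ℕ → ℕ → ℕ → ℕ → ℕ
weightℕ k l x y = (1 + (k + k)) * x + (1 + (l + l)) * y

penaltyℕ : ℕ → ℕ → ℕ → ℕ → ℕ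
penaltyℕ s t k l = s * (k * (k + 1)) + t * (l * (l + 1))

pos-weight : ∀ k l x y → + weightℕ k l x y ≡ weight (+ k) (+ l) (+ x) (+ y)
pos-weight k l x y = cong₂ ℤ._+_ (ℤ.pos-* (1 + (k + k)) x) (ℤ.pos-* (1 + (l + l)) y)

pos-penalty : ∀ s t k l → + penaltyℕ s t k l ≡ penalty (+ s) (+ t) (+ k) (+ l)
pos-penalty s t k l = cong₂ ℤ._+_
  (trans (ℤ.pos-* s _) (cong (+ s ℤ.*_) (ℤ.pos-* k (k + 1))))
  (trans (ℤ.pos-* t _) (cong (+ t ℤ.*_) (ℤ.pos-* l (l + 1))))

-- Moving d vertices to the side of larger slope gains 2(k-l) for each of them.
weight-exchange : ∀ {k l m N x y} → l ≤ k → m ≤ x → m + N ≡ x + y →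
  ∃ λ κ → ∃ λ d → k ≡ l + κ × x ≡ m + d × weightℕ k l x y ≡ weightℕ k l m N + (κ + κ) * d
weight-exchange {k} {l} {m} {N} {x} {y} l≤k m≤x eq
  with m≤n⇒∃[o]m+o≡n l≤k | m≤n⇒∃[o]m+o≡n m≤x
... | κ , refl | d , refl = κ , d , refl , refl ,
  trans (identity l κ m d y) (cong (λ N → weightℕ k l m N + (κ + κ) * d) (sym N≡))
  where
  N≡ : N ≡ d + y
  N≡ = +-cancelˡ-≡ m _ _ (trans eq (+-assoc m d y))
  identity : ∀ l κ m d y →
    (1 + ((l + κ) + (l + κ))) * (m + d) + (1 + (l + l)) * y
      ≡ (1 + ((l + κ) + (l + κ))) * m + (1 + (l + l)) * (d + y) + (κ + κ) * d
  identity = solve-∀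

weight-mono : ∀ {k l m N x y} → l ≤ k → m ≤ x → m + N ≡ x + y → weightℕ k l m N ≤ weightℕ k l x y
weight-mono l≤k m≤x eq with weight-exchange l≤k m≤x eq
... | _ , _ , _ , _ , w≡ = ≤-trans (m≤m+n _ _) (≤-reflexive (sym w≡))

weight-tight : ∀ {k l m N x y} → l ≤ k → m ≤ x → m + N ≡ x + y →
               weightℕ k l x y ≤ weightℕ k l m N → k ≡ l ⊎ m ≡ x
weight-tight {k} {l} {m} {N} l≤k m≤x eq tight with weight-exchange l≤k m≤x eq
... | κ , d , k≡ , x≡ , w≡ with m*n≡0⇒m≡0∨n≡0 (κ + κ) (n≤0⇒n≡0 (+-cancelˡ-≤ (weightℕ k l m N) ((κ + κ) * d) 0
         (≤-trans (≤-reflexive (sym w≡)) (≤-trans tight (≤-reflexive (sym (+-identityʳ _)))))))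
...   | inj₁ κ+κ≡0 = inj₁ (trans k≡ (trans (cong (λ κ → l + κ) (m+n≡0⇒m≡0 κ κ+κ≡0)) (+-identityʳ l)))
...   | inj₂ d≡0   = inj₂ (sym (trans x≡ (trans (cong (λ d → m + d) d≡0) (+-identityʳ m))))

-- Selecting the two groups of parts

-- Takes a indices from T and b from outside it: later, a parts of size k+1 and b parts of size k.
choose : ∀ {r} (T : Subset r) a b → a ≤ ∣ T ∣ → b ≤ ∣ ∁ T ∣ →
         ∃ λ S → sum (λ i → χ S i * χ T i) ≡ a × ∣ S ∣ ≡ a + b
choose []            zero    zero    _        _        = [] , refl , refl
choose (inside  ∷ T) zero    b       _        b≤       with choose T 0 b z≤n b≤
... | S , meet , card = outside ∷ S , meet , card
choose (inside  ∷ T) (suc a) b       (s≤s a≤) b≤       with choose T a b a≤ b≤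
... | S , meet , card = inside ∷ S , cong suc meet , cong suc card
choose (outside ∷ T) a       zero    a≤       _        with choose T a 0 a≤ z≤n
... | S , meet , card = outside ∷ S , meet , card
choose (outside ∷ T) a       (suc b) a≤       (s≤s b≤) with choose T a b a≤ b≤
... | S , meet , card = inside ∷ S , meet , trans (cong suc card) (sym (+-suc a b))

enlarge : ∀ {r} (T : Subset r) s → ∣ T ∣ ≤ s → s ≤ r → ∃ λ S → T ⊆ S × ∣ S ∣ ≡ s
enlarge []            zero    _        _        = [] , id , refl
enlarge (inside  ∷ T) (suc s) (s≤s T≤) (s≤s s≤) with enlarge T s T≤ s≤
... | S , T⊆S , card = inside ∷ S , in⊆in T⊆S , cong suc card
enlarge {suc r} (outside ∷ T) s T≤ s≤ with s ≤? r
... | yes s≤r with enlarge T s T≤ s≤r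
...   | S , T⊆S , card = outside ∷ S , out⊆ T⊆S , card
enlarge {suc r} (outside ∷ T) s T≤ s≤ | no s≰r =
  ⊤ , (λ _ → ∈⊤) , trans (∣⊤∣≡n (suc r)) (≤-antisym (≰⇒> s≰r) s≤)

module _ {r} (f : Fin r → ℕ) where

  -- As m = w + ks, the selection consists of w parts of size k+1 and s - w of size k. There are
  -- enough large ones because S has total at least m but at most ks + |T|. There are enough small
  -- ones because N < (k+1)t and the sum of all sizes give |T| < w + t.
  rebalance : ∀ {s t m N k} → s + t ≡ r → sum f ≡ m + N → (∀ i → Near k (f i)) →
    ∀ S → ∣ S ∣ ≡ s → m ≤ size f S →
    ∀ w → m ≡ w + k * s → w < s → N < suc k * t →
    ∃ λ S′ → ∣ S′ ∣ ≡ s × size f S′ ≡ m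
  rebalance {s} {t} {m} {N} {k} s+t≡r Σf near S ∣S∣≡s m≤ w m≡ w<s N< = S′ ,
    trans card (m+[n∸m]≡n (<⇒≤ w<s)) ,
    trans (size-near S′) (trans (cong₂ _+_ (cong (_* k) (trans card (m+[n∸m]≡n (<⇒≤ w<s)))) meet)
                                (trans (trans (+-comm (s * k) w) (cong (λ x → w + x) (*-comm s k))) (sym m≡)))
    where
    open ≤-Reasoning
    T : Subset r
    T = tabulate (λ i → does (f i ℕ.≟ suc k))
    f≡ : ∀ i → f i ≡ k + χ T i
    f≡ i with near i
    ... | inj₁ fi≡k = trans fi≡k (trans (sym (+-identityʳ k)) (cong (λ x → k + x) (sym (⟦⟧-false (i ∈? T) λ i∈ →
            1+n≢n (trans (sym (∈-tabulate⁻ (λ i → f i ℕ.≟ suc k) i∈)) fi≡k)))))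
    ... | inj₂ fi≡k+1 = trans fi≡k+1 (trans (+-comm 1 k) (cong (λ x → k + x) (sym (⟦⟧-true (i ∈? T)
            (∈-tabulate⁺ (λ i → f i ℕ.≟ suc k) fi≡k+1)))))
    size-near : ∀ S → size f S ≡ ∣ S ∣ * k + sum (λ i → χ S i * χ T i)
    size-near S = begin-equality
      size f S
        ≡⟨ sum-cong-≗ (λ i → trans (cong (χ S i *_) (f≡ i)) (*-distribˡ-+ (χ S i) k (χ T i))) ⟩
      sum (λ i → χ S i * k + χ S i * χ T i)
        ≡⟨ ∑-distrib-+ (λ i → χ S i * k) (λ i → χ S i * χ T i) ⟩
      sum (λ i → χ S i * k) + sum (λ i → χ S i * χ T i)
        ≡⟨ cong (λ x → x + sum (λ i → χ S i * χ T i))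
             (trans (sym (*-distribʳ-sum k (χ S))) (cong (_* k) (sym (∣p∣≡sum-χ S)))) ⟩
      ∣ S ∣ * k + sum (λ i → χ S i * χ T i) ∎
    w≤∣T∣ : w ≤ ∣ T ∣
    w≤∣T∣ = +-cancelʳ-≤ (k * s) w ∣ T ∣ (begin
      w + k * s                             ≡⟨ m≡ ⟨
      m                                     ≤⟨ m≤ ⟩
      size f S                              ≡⟨ size-near S ⟩
      ∣ S ∣ * k + sum (λ i → χ S i * χ T i) ≤⟨ +-monoʳ-≤ (∣ S ∣ * k) (sum-mono-≤ below) ⟩
      ∣ S ∣ * k + sum (χ T)                 ≡⟨ cong₂ _+_ (trans (cong (_* k) ∣S∣≡s) (*-comm s k)) (sym (∣p∣≡sum-χ T)) ⟩
      k * s + ∣ T ∣                         ≡⟨ +-comm (k * s) ∣ T ∣ ⟩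
      ∣ T ∣ + k * s                         ∎)
      where
      below : ∀ i → χ S i * χ T i ≤ χ T i
      below i with i ∈? S
      ... | yes _ = ≤-reflexive (*-identityˡ _)
      ... | no _  = z≤n
    total : m + N ≡ r * k + ∣ T ∣
    total = begin-equality
      m + N                ≡⟨ Σf ⟨
      sum f                ≡⟨ sum-χ-⊤ f ⟨
      size f ⊤             ≡⟨ size-near ⊤ ⟩
      ∣ ⊤ {r} ∣ * k + sum (λ i → χ ⊤ i * χ T i)
        ≡⟨ cong₂ (λ x y → x * k + y) (∣⊤∣≡n r) (trans (sum-χ-⊤ (χ T)) (sym (∣p∣≡sum-χ T))) ⟩
      r * k + ∣ T ∣        ∎
    ∣T∣<w+t : ∣ T ∣ < w + t
    ∣T∣<w+t = +-cancelˡ-< (r * k) ∣ T ∣ (w + t) (begin-strict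
      r * k + ∣ T ∣                ≡⟨ total ⟨
      m + N                        ≡⟨ cong (λ x → x + N) m≡ ⟩
      w + k * s + N                <⟨ +-monoʳ-< (w + k * s) N< ⟩
      w + k * s + suc k * t        ≡⟨ identity w k s t ⟩
      (s + t) * k + (w + t)        ≡⟨ cong (λ x → x * k + (w + t)) s+t≡r ⟩
      r * k + (w + t)              ∎)
      where
      identity : ∀ w k s t → w + k * s + suc k * t ≡ (s + t) * k + (w + t)
      identity = solve-∀
    s∸w≤ : s ∸ w ≤ ∣ ∁ T ∣
    s∸w≤ = subst (s ∸ w ≤_) (sym (∣∁p∣≡n∸∣p∣ T)) (m+n≤o⇒m≤o∸n (s ∸ w) (begin
      s ∸ w + ∣ T ∣     ≤⟨ +-monoʳ-≤ (s ∸ w) (<⇒≤ ∣T∣<w+t) ⟩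
      s ∸ w + (w + t)   ≡⟨ +-assoc (s ∸ w) w t ⟨
      s ∸ w + w + t     ≡⟨ cong (λ x → x + t) (m∸n+n≡m (<⇒≤ w<s)) ⟩
      s + t             ≡⟨ s+t≡r ⟩
      r                 ∎))
    chosen = choose T w (s ∸ w) w≤∣T∣ s∸w≤
    S′ = proj₁ chosen
    meet = proj₁ (proj₂ chosen)
    card = proj₂ (proj₂ chosen)

  balanced-groups : ∀ {s t m N k l} → s + t ≡ r → sum f ≡ m + N → l ≤ k →
    ∀ w → m ≡ w + k * s → w < s → N < suc l * t →
    (S : Subset r) → ∣ S ∣ ≡ s → m ≤ size f S →
    sum (λ i → f i * f i) + penaltyℕ s t k l ≤ weightℕ k l m N →
    ∃ λ S′ → ∣ S′ ∣ ≡ s × size f S′ ≡ m ×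
             (∀ i → i ∈ S′ → Near k (f i)) × (∀ i → i ∈ ∁ S′ → Near l (f i))
  balanced-groups {s} {t} {m} {N} {k} {l} s+t≡r Σf l≤k w m≡ w<s N< S ∣S∣≡s m≤ tight = conclude (weight-tight l≤k m≤ (sym x+y) (≤-trans lower upper))
    where
    x = size f S
    y = size f (∁ S)
    ∣∁S∣≡t : ∣ ∁ S ∣ ≡ t
    ∣∁S∣≡t = trans (∣∁p∣≡n∸∣p∣ S) (trans (cong₂ _∸_ (sym s+t≡r) ∣S∣≡s) (m+n∸m≡n s t))
    x+y : x + y ≡ m + N
    x+y = trans (sum-χ-∁ S f) Σf
    a b : ℕ
    a = squares f S + ∣ S ∣ * (k * (k + 1))
    b = squares f (∁ S) + ∣ ∁ S ∣ * (l * (l + 1))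
    lower : weightℕ k l x y ≤ a + b
    lower = +-mono-≤ (squares-≥ f k S) (squares-≥ f l (∁ S))
    a+b : a + b ≡ sum (λ i → f i * f i) + penaltyℕ s t k l
    a+b = begin
      squares f S + ∣ S ∣ * (k * (k + 1)) + (squares f (∁ S) + ∣ ∁ S ∣ * (l * (l + 1)))
        ≡⟨ interchange (squares f S) (∣ S ∣ * (k * (k + 1))) (squares f (∁ S)) (∣ ∁ S ∣ * (l * (l + 1))) ⟩
      squares f S + squares f (∁ S) + penaltyℕ ∣ S ∣ ∣ ∁ S ∣ k l
        ≡⟨ cong₂ _+_ (sum-χ-∁ S (λ i → f i * f i)) (cong₂ (λ s t → penaltyℕ s t k l) ∣S∣≡s ∣∁S∣≡t) ⟩
      sum (λ i → f i * f i) + penaltyℕ s t k l ∎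
      where
      open ≡-Reasoning
      interchange : ∀ a b c d → a + b + (c + d) ≡ a + c + (b + d)
      interchange = solve-∀
    upper : a + b ≤ weightℕ k l m N
    upper = ≤-trans (≤-reflexive a+b) tight
    -- This closes the cycle weight(x,y) ≤ a + b ≤ weight(m,N) ≤ weight(x,y), so every inequality in
    -- it is an equality.
    tight′ : a + b ≤ weightℕ k l x y
    tight′ = ≤-trans upper (weight-mono l≤k m≤ (sym x+y))
    near-S : ∀ i → i ∈ S → Near k (f i)
    near-S = squares-tight f k S (+-tightˡ (squares-≥ f k S) (squares-≥ f l (∁ S)) tight′)
    near-∁S : ∀ i → i ∈ ∁ S → Near l (f i)
    near-∁S = squares-tight f l (∁ S) (+-tightʳ (squares-≥ f k S) (squares-≥ f l (∁ S)) tight′)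
    near-all : k ≡ l → ∀ i → Near k (f i)
    near-all k≡l i with i ∈? S
    ... | yes i∈S = near-S i i∈S
    ... | no  i∉S = subst (λ k → Near k (f i)) (sym k≡l) (near-∁S i (x∉p⇒x∈∁p i∉S))
    -- Either S already has total m, or k = l and all parts are interchangeable up to one vertex.
    conclude : k ≡ l ⊎ m ≡ x →
      ∃ λ S′ → ∣ S′ ∣ ≡ s × size f S′ ≡ m ×
               (∀ i → i ∈ S′ → Near k (f i)) × (∀ i → i ∈ ∁ S′ → Near l (f i))
    conclude (inj₂ m≡x) = S , ∣S∣≡s , sym m≡x , near-S , near-∁S
    conclude (inj₁ k≡l) =
      let S′ , card , size≡ = rebalance s+t≡r Σf (near-all k≡l) S ∣S∣≡s m≤ w m≡ w<s
                                (subst (λ k → N < suc k * t) (sym k≡l) N<) in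
      S′ , card , size≡ , (λ i _ → near-all k≡l i) ,
      (λ i _ → subst (λ k → Near k (f i)) k≡l (near-all k≡l i))

-- Translating the hypotheses

α-witness : ∀ {n} s (G : Graph (Fin n)) {m} → m ≤ α s G →
            ∃ λ M → m ≤ ∣ M ∣ × ¬ Clique G (_∈ M) (suc s)
α-witness {n} s G {m} m≤α = attained (Extrema.argmax-sel id 0 (List.map ∣_∣ (List.filter free? (subsets n))))
  where
  free? : ∀ M → Dec (¬ ((G [[ M ]]) Contains (K (suc s))))
  free? M = ¬? (contains? G M (K (suc s)))
  attained : α s G ≡ 0 ⊎ α s G ∈ˡ List.map ∣_∣ (List.filter free? (subsets n)) →
             ∃ λ M → m ≤ ∣ M ∣ × ¬ Clique G (_∈ M) (suc s)
  -- If the maximum is the default 0, then m = 0 and the empty set serves.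
  attained (inj₁ α≡0) = ⊥ , ≤-trans m≤α (≤-trans (≤-reflexive α≡0) z≤n) , λ Q → ∉⊥ (member Q zero)
  attained (inj₂ ∈α) = let M , M∈ , α≡ = ∈-map⁻ ∣_∣ ∈α in
    M , ≤-trans m≤α (≤-reflexive α≡) , proj₂ (∈-filter⁻ free? {xs = subsets n} M∈) ∘ clique⇒contains

-- One vertex from each part that M meets gives a clique in M, so M meets at most s parts; these are
-- padded to exactly s.
parts-covering : ∀ {n r} {G : Graph (Fin n)} (P : Fin n → Fin r) → IsCompleteMultipartite G P →
  ∀ M s → s ≤ r → ¬ Clique G (_∈ M) (suc s) →
  ∃ λ S → ∣ S ∣ ≡ s × ∣ M ∣ ≤ size (partSize P) S
parts-covering {n} {r} {G} P (_ , adj) M s s≤r free = S , card , (begin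
  ∣ M ∣                          ≡⟨ ∣p∣≡sum-χ M ⟩
  sum (χ M)                      ≤⟨ sum-mono-≤ M⊆ ⟩
  sum (λ v → χ S (P v))          ≡⟨ sum-parts P (χ S) ⟨
  size (partSize P) S            ∎)
  where
  open ≤-Reasoning
  met? : ∀ i → Dec (∃ λ v → v ∈ M × P v ≡ i)
  met? i = any? λ v → v ∈? M ×-dec P v ≟ i
  T : Subset r
  T = tabulate (λ i → does (met? i))
  ∣T∣≤s : ∣ T ∣ ≤ s
  ∣T∣≤s = ≮⇒≥ λ s<∣T∣ → let h , met , h≢ = pick-distinct met? (suc s) (subst (suc s ≤_) (∣tabulate∣ (λ i → does (met? i))) s<∣T∣) in
    free (clique (λ i → proj₁ (met i)) (λ i → proj₁ (proj₂ (met i)))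
      λ i j i≢j → adj _ _ λ eq → h≢ i j i≢j (trans (sym (proj₂ (proj₂ (met i)))) (trans eq (proj₂ (proj₂ (met j))))))
  enlarged = enlarge T s ∣T∣≤s s≤r
  S = proj₁ enlarged
  card = proj₂ (proj₂ enlarged)
  M⊆ : ∀ v → χ M v ≤ χ S (P v)
  M⊆ v with v ∈? M
  ... | no _    = z≤n
  ... | yes v∈M = ≤-reflexive (sym (⟦⟧-true (P v ∈? S)
                    (proj₁ (proj₂ enlarged) (∈-tabulate⁺ met? (v , v∈M , refl)))))

-- The ceiling is the negated floor of the negation, so the defining inequality of integer division
-- is negated.
ceiling-≤ : ∀ a r .{{_ : NonZero r}} m → ceiling (+ a / r) ≤ᶻ + m → a ≤ m * r
ceiling-≤ a r@(suc _) m h = ℤ.drop‿+≤+ (begin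
  + a                                   ≡⟨ ℤ.neg-involutive (+ a) ⟨
  ℤ.- (ℤ.- + a)                         ≤⟨ ℤ.neg-mono-≤ (ℤ.[n/d]*d≤n (ℤ.- + a) (+ r)) ⟩
  ℤ.- ((ℤ.- + a) ℤ./ + r ℤ.* + r)       ≡⟨ ℤ.neg-distribˡ-* ((ℤ.- + a) ℤ./ + r) (+ r) ⟩
  ℤ.- ((ℤ.- + a) ℤ./ + r) ℤ.* + r       ≤⟨ ℤ.*-monoʳ-≤-nonNeg (+ r) h ⟩
  + m ℤ.* + r                           ≡⟨ ℤ.pos-* m r ⟨
  + (m * r)                             ∎)
  where open ℤ.≤-Reasoning

group-squares : ∀ {n r} (P : Fin n → Fin r) S c N .{{_ : NonZero c}} → IsBalancedGroup P S c N →
  let k = N ℕ./ c in squares (partSize P) S + c * (k * (k + 1)) ≡ (1 + (k + k)) * N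
group-squares P S c N record { count = refl ; totalSize = total ; balanced = balanced } =
  trans (sym (squares-near f k S (balanced⇒near f S N size≡N balanced))) (cong ((1 + (k + k)) *_) size≡N)
  where
  f = partSize P
  k = N ℕ./ c
  size≡N : size f S ≡ N
  size≡N = trans (sym (totalSize≡size P S)) total

near⇒balanced : ∀ {n r} (P : Fin n → Fin r) S {c N k} → ∣ S ∣ ≡ c → size (partSize P) S ≡ N →
  (∀ i → i ∈ S → Near k (partSize P i)) → IsBalancedGroup P S c N
near⇒balanced P S card size≡N near = record
  { count     = card
  ; totalSize = trans (totalSize≡size P S) size≡N
  ; balanced  = λ i j i∈S j∈S → near-∣-∣ (near i i∈S) (near j j∈S)
  }

-- Comparison with the extremal graph

module _ {n r} (G : Graph (Fin n)) (s q m : ℕ) .{{_ : NonZero s}} .{{_ : NonZero q}} (s+q≡r : s + q ≡ r) where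

  private
    N = n ∸ m
    k = m ℕ./ s
    l = N ℕ./ q
    W B₁ B₂ : ℕ
    W  = nonadjacencies G ⊤
    B₁ = nonadjacencies (turán s m) ⊤
    B₂ = nonadjacencies (turán q N) ⊤
    bound = m * N + t q N + t s m

  turán-weight : B₁ + B₂ + penaltyℕ s q k l ≡ weightℕ k l m N
  turán-weight = trans (interchange B₁ B₂ (s * (k * (k + 1))) (q * (l * (l + 1))))
                       (cong₂ _+_ (turán-nonadjacencies s m) (turán-nonadjacencies q N))
    where
    interchange : ∀ a b c d → a + b + (c + d) ≡ (a + c) + (b + d)
    interchange = solve-∀

  -- Expanding n² = (m+N)² reduces the comparison of `e G` with `bound` to that of `W` with
  -- `B₁ + B₂`, in the opposite direction.
  edges+nonadjacencies : m ≤ n → e G + e G + W ≡ bound + bound + (B₁ + B₂)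
  edges+nonadjacencies m≤n = begin
    e G + e G + W
      ≡⟨ e+e+nonadjacencies G ⟩
    n * n
      ≡⟨ cong (λ n → n * n) (m+[n∸m]≡n m≤n) ⟨
    (m + N) * (m + N)
      ≡⟨ square m N ⟩
    m * N + m * N + (N * N + m * m)
      ≡⟨ cong₂ (λ x y → m * N + m * N + (x + y))
           (e+e+nonadjacencies (turán q N)) (e+e+nonadjacencies (turán s m)) ⟨
    m * N + m * N + (t q N + t q N + B₂ + (t s m + t s m + B₁))
      ≡⟨ regroup (m * N) (t q N) (t s m) B₁ B₂ ⟩
    bound + bound + (B₁ + B₂) ∎
    where
    open ≡-Reasoning
    square : ∀ m N → (m + N) * (m + N) ≡ m * N + m * N + (N * N + m * m)
    square = solve-∀
    regroup : ∀ x y z a b → x + x + (y + y + b + (z + z + a)) ≡ (x + y + z) + (x + y + z) + (a + b)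
    regroup = solve-∀

  extremal⇒nonadjacencies : IsExtremal r s m G → q ≡ r ∸ s → W ≡ B₁ + B₂
  extremal⇒nonadjacencies (P , complete , S , groupˢ , groupᵠ) refl = begin
    W
      ≡⟨ multipartite-nonadjacencies P {G} complete ⟩
    sum (λ i → f i * f i)
      ≡⟨ sum-χ-∁ S (λ i → f i * f i) ⟨
    squares f S + squares f (∁ S)
      ≡⟨ cong₂ _+_
           (+-cancelʳ-≡ (s * (k * (k + 1))) _ _
             (trans (group-squares P S s m groupˢ) (sym (turán-nonadjacencies s m))))
           (+-cancelʳ-≡ (q * (l * (l + 1))) _ _
             (trans (group-squares P (∁ S) q N groupᵠ) (sym (turán-nonadjacencies q N)))) ⟩
    B₁ + B₂ ∎
    where
    open ≡-Reasoning
    f = partSize P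

  module _ (m≤n : m ≤ n) (sn≤mr : s * n ≤ m * r) (M : Subset n) (m≤∣M∣ : m ≤ ∣ M ∣)
           (freeG : ¬ Clique G (_∈ ⊤) (suc r)) (freeM : ¬ Clique G (_∈ M) (suc s)) where

    private
      x = in-M G M ⊤
      y = out-M G M ⊤

      x≡∣M∣ : x ≡ ∣ M ∣
      x≡∣M∣ = trans (sum-χ-⊤ (χ M)) (sym (∣p∣≡sum-χ M))

      m≤x : m ≤ x
      m≤x = subst (m ≤_) (sym x≡∣M∣) m≤∣M∣

      m+N≡x+y : m + N ≡ x + y
      m+N≡x+y = trans (m+[n∸m]≡n m≤n) (sym (trans (in+out G M ⊤) (trans (sym (∣p∣≡sum-χ (⊤ {n}))) (∣⊤∣≡n n))))

      free : FreeWithin G M ⊤ s q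
      free = subst (λ r → ¬ Clique G (_∈ ⊤) (suc r)) (sym s+q≡r) freeG , freeM ∘ weaken proj₂

      -- Subtracting sm from sn ≤ mr leaves sN ≤ mq, and lq ≤ N.
      l≤k : l ≤ k
      l≤k = m*n≤o⇒m≤o/n l s m (*-cancelʳ-≤ (l * s) m q (begin
        l * s * q       ≡⟨ swap l s q ⟩
        s * (l * q)     ≤⟨ *-monoʳ-≤ s (m/n*n≤m N q) ⟩
        s * N           ≤⟨ +-cancelˡ-≤ (s * m) _ _ (begin
          s * m + s * N   ≡⟨ *-distribˡ-+ s m N ⟨
          s * (m + N)     ≡⟨ cong (s *_) (m+[n∸m]≡n m≤n) ⟩
          s * n           ≤⟨ sn≤mr ⟩
          m * r           ≡⟨ cong (m *_) s+q≡r ⟨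
          m * (s + q)     ≡⟨ trans (*-distribˡ-+ m s q) (cong (λ a → a + m * q) (*-comm m s)) ⟩
          s * m + m * q   ∎) ⟩
        m * q           ∎))
        where
        open ≤-Reasoning
        swap : ∀ l s q → l * s * q ≡ s * (l * q)
        swap = solve-∀

      weight≤ : weightℕ k l m N ≤ weightℕ k l x y
      weight≤ = weight-mono l≤k m≤x m+N≡x+y

      weight≤W : weightℕ k l x y ≤ W + penaltyℕ s q k l
      weight≤W = ℤ.drop‿+≤+ (subst₂ _≤ᶻ_ (sym (pos-weight k l x y))
        (cong (λ p → + W ℤ.+ p) (sym (pos-penalty s q k l)))
        (nonadjacencies-bound G M _ s q ⊤ (+≤+ l≤k) (n<1+n _) free))

    turán≤nonadjacencies : B₁ + B₂ ≤ W
    turán≤nonadjacencies = +-cancelʳ-≤ (penaltyℕ s q k l) _ _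
      (≤-trans (≤-reflexive turán-weight) (≤-trans weight≤ weight≤W))

    complete⇒extremal : ∀ P → IsCompleteMultipartite G P →
                        W + penaltyℕ s q k l ≤ weightℕ k l m N → IsExtremal r s m G
    complete⇒extremal P complete tight =
      let S₀ , ∣S₀∣≡s , ∣M∣≤ = parts-covering {G = G} P complete M s (subst (s ≤_) s+q≡r (m≤m+n s q)) freeM in
      conclude (balanced-groups f s+q≡r Σf≡ l≤k (m % s) (m≡m%n+[m/n]*n m s) (m%n<n m s) N< S₀ ∣S₀∣≡s
                                (≤-trans m≤∣M∣ ∣M∣≤) tight′)
      where
      f : Fin r → ℕ
      f = partSize P
      Σf≡ : sum f ≡ m + N
      Σf≡ = trans (sum-partSize P) (sym (m+[n∸m]≡n m≤n))
      N< : N < suc l * q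
      N< = subst (_< suc l * q) (sym (m≡m%n+[m/n]*n N q)) (+-monoˡ-< (l * q) (m%n<n N q))
      tight′ : sum (λ i → f i * f i) + penaltyℕ s q k l ≤ weightℕ k l m N
      tight′ = subst (λ a → a + penaltyℕ s q k l ≤ weightℕ k l m N)
                     (multipartite-nonadjacencies P {G} complete) tight
      conclude : (∃ λ S → ∣ S ∣ ≡ s × size f S ≡ m ×
                          (∀ i → i ∈ S → Near k (f i)) × (∀ i → i ∈ ∁ S → Near l (f i))) →
                 IsExtremal r s m G
      conclude (S , card , size≡m , nearˢ , nearᵠ) =
        P , complete , S , near⇒balanced P S card size≡m nearˢ , near⇒balanced P (∁ S) card-∁ size-∁ nearᵠ
        where
        card-∁ : ∣ ∁ S ∣ ≡ r ∸ s
        card-∁ = trans (∣∁p∣≡n∸∣p∣ S) (cong (r ∸_) card)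
        size-∁ : size f (∁ S) ≡ N
        size-∁ = +-cancelˡ-≡ m _ _ (trans (cong (λ a → a + size f (∁ S)) (sym size≡m))
                                          (trans (sum-χ-∁ S f) Σf≡))

    nonadjacencies⇒extremal : W ≡ B₁ + B₂ → IsExtremal r s m G
    nonadjacencies⇒extremal W≡ = complete⇒extremal (proj₁ coloured) (proj₂ coloured) W≤
      where
      W≤ : W + penaltyℕ s q k l ≤ weightℕ k l m N
      W≤ = ≤-reflexive (trans (cong (λ a → a + penaltyℕ s q k l) W≡) turán-weight)
      -- The weight at (x,y) is at least that at (m,N), so equality at m forces tightness for M even
      -- if M has more than m vertices.
      tight : Tight G M (+ k) (+ l) s q
      tight = subst₂ _≤ᶻ_ (cong (λ p → + W ℤ.+ p) (pos-penalty s q k l)) (pos-weight k l x y)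
                (+≤+ (≤-trans W≤ weight≤))
      coloured : Σ (Fin n → Fin r) (IsCompleteMultipartite G)
      coloured = relabel {G = G} (≤-reflexive s+q≡r) (tight⇒multipartite G M s q (+≤+ l≤k) free tight)

double-cancel-≤ : ∀ {a b x y} → a + a + x ≡ b + b + y → y ≤ x → a ≤ b
double-cancel-≤ {a} {b} {x} {y} eq y≤x = ≮⇒≥ λ b<a →
  <⇒≱ (+-mono-<-≤ (+-mono-< b<a b<a) y≤x) (≤-reflexive eq)

theorem1 :
    ∀ (r s : ℕ) (1≤s : 1 ≤ s) (s<r : s < r) →
    let instance
          s≢0 : NonZero s
          s≢0 = >-nonZero 1≤s
          r≢0 : NonZero r
          r≢0 = >-nonZero (m<n⇒0<n s<r)
          r-s≢0 : NonZero (r ∸ s)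
          r-s≢0 = >-nonZero (m<n⇒0<n∸m s<r)
    in
    ∀ (n : ℕ) (G : Graph (Fin n)) → G IsFreeOf K (suc r) →
    ∀ (m : ℕ) → m ≤ α s G → ceiling (+ (s * n) / r) ≤ᶻ + m →
    let bound = m * (n ∸ m) + t (r ∸ s) (n ∸ m) + t s m in
    e G ≤ bound × (e G ≡ bound ⇔ IsExtremal r s m G)
theorem1 r s 1≤s s<r n G free m m≤α sn/r≤m =
  double-cancel-≤ edges turán≤W , mk⇔ to from
  where
  instance
    s≢0 : NonZero s
    s≢0 = >-nonZero 1≤s
    r≢0 : NonZero r
    r≢0 = >-nonZero (m<n⇒0<n s<r)
    r-s≢0 : NonZero (r ∸ s)
    r-s≢0 = >-nonZero (m<n⇒0<n∸m s<r)
  N = n ∸ m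
  bound = m * N + t (r ∸ s) N + t s m
  W = nonadjacencies G ⊤
  B = nonadjacencies (turán s m) ⊤ + nonadjacencies (turán (r ∸ s) N) ⊤
  s+q≡r : s + (r ∸ s) ≡ r
  s+q≡r = m+[n∸m]≡n (<⇒≤ s<r)
  witness = α-witness s G m≤α
  M = proj₁ witness
  m≤∣M∣ = proj₁ (proj₂ witness)
  freeM = proj₂ (proj₂ witness)
  -- Ensures that the truncated difference `n ∸ m` is a true one.
  m≤n : m ≤ n
  m≤n = ≤-trans m≤∣M∣ (∣p∣≤n M)
  sn≤mr : s * n ≤ m * r
  sn≤mr = ceiling-≤ (s * n) r m sn/r≤m
  freeG : ¬ Clique G (_∈ ⊤) (suc r)
  freeG Q = free (vertex Q , (λ eq → distinct Q _ _ eq) , adjacent Q)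
  edges : e G + e G + W ≡ bound + bound + B
  edges = edges+nonadjacencies G s (r ∸ s) m s+q≡r m≤n
  turán≤W : B ≤ W
  turán≤W = turán≤nonadjacencies G s (r ∸ s) m s+q≡r m≤n sn≤mr M m≤∣M∣ freeG freeM
  to : e G ≡ bound → IsExtremal r s m G
  to e≡ = nonadjacencies⇒extremal G s (r ∸ s) m s+q≡r m≤n sn≤mr M m≤∣M∣ freeG freeM
    (+-cancelˡ-≡ (bound + bound) W B (trans (cong (λ a → a + a + W) (sym e≡)) edges))
  from : IsExtremal r s m G → e G ≡ bound
  from ext = ≤-antisym (double-cancel-≤ edges (≤-reflexive (sym W≡))) (double-cancel-≤ (sym edges) (≤-reflexive W≡))
    where
    W≡ : W ≡ B
    W≡ = extremal⇒nonadjacencies G s (r ∸ s) m s+q≡r ext refl
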